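{- Let $(G,\sigma)$ be a connection graph. Then $\sigma$ is absolutely inconsistent (i.e. the connection Laplacian $\mathcal{L}^\sigma$ is invertible) if and only if for every $i\in V$ the matrix $I_{d\times d}-\Omega^1_i$ is positive definite.
   Context: A connection graph $(G,\sigma)$: finite connected weighted graph $G=(V,E,W)$, $V=\{1,\dots,n\}$, $w_{ij}>0$ iff $\{i,j\}\in E$, $\deg(i)=\sum_j w_{ij}$, and $\sigma$ mapping oriented edges to $\mathsf{O}(d)$ with $\sigma_{ji}=\sigma_{ij}^{\mathrm T}$. $\mathcal{L}^\sigma$ is the $nd\times nd$ block matrix with blocks $\deg(i)I_d$ on the diagonal, $-w_{ij}\sigma_{ij}$ for $i\sim j$, $0$ otherwise. Let $(X_t)$ be the simple random walk with transition probabilities $w_{ij}/\deg(i)$, $T^1_i=\inf\{t\ge1: X_t=i\}$, and $\Omega^1_i=\mathbb{E}\big[\prod_{\ell=1}^{T^1_i}\sigma_{X_{\ell-1}X_\ell}\mid X_0=i\big]$ (ordered product). -}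

module Defs where

open import Algebra.Bundles using (CommutativeRing)
open import Algebra.Apartness.Bundles using (HeytingField)
import Algebra.Definitions as AlgDefs
import Algebra.Definitions.RawMonoid as RawMonoidDefs
open import Data.Bool.Base using (if_then_else_)
open import Data.Empty using (⊥-elim)
open import Data.Fin.Base using (Fin; zero; suc; toℕ; remQuot; punchIn)
open import Data.Fin.Properties using (_≟_; punchInᵢ≢i)
open import Data.Nat.Base as ℕ using (ℕ; zero; suc; s≤s)
open import Data.Product.Base using (∃-syntax; _×_; _,_; proj₁; proj₂)
open import Data.Sum.Base using (_⊎_; inj₁; inj₂)
open import Data.Vec.Base using (Vec; []; _∷_; init; last)
open import Data.Vec.Functional using (Vector)
open import Data.Vec.Relation.Unary.All using (All; all?)
open import Function.Bundles using (_⇔_; Equivalence)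
open import Level using (Level; 0ℓ; _⊔_) renaming (suc to lsuc)
open import Relation.Binary.Core using (Rel)
open import Relation.Binary.Definitions using (Decidable)
open import Relation.Binary.Structures using (IsStrictPartialOrder)
open import Relation.Binary.Construct.Closure.ReflexiveTransitive using (Star; ε; _◅_)
open import Relation.Binary.PropositionalEquality.Core as ≡ using (_≡_; _≢_)
open import Relation.Nullary.Decidable using (Dec; yes; no; does; ¬?; _×-dec_)
open import Relation.Nullary.Negation using (¬_)

-- The reals, axiomatised as a Cauchy-complete Archimedean ordered field.
-- The order axioms are the constructive ones (no decidability of _<_ is
-- assumed), so that both constructive and classical real numbers are models;
-- classically, _#_ is inequality and ℝ is the only model up to isomorphism.

record OrderedField (c ℓ₁ ℓ₂ ℓ₃ : Level) : Set (lsuc (c ⊔ ℓ₁ ⊔ ℓ₂ ⊔ ℓ₃)) where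
  infix 4 _<_ _≤_
  field
    heytingField : HeytingField c ℓ₁ ℓ₂

  open HeytingField heytingField public
    renaming (Carrier to ℝ; zero to *-zero)

  field
    _<_                  : Rel ℝ ℓ₃
    isStrictPartialOrder : IsStrictPartialOrder _≈_ _<_
    #⇔<⊎>                : ∀ {x y} → x # y ⇔ (x < y ⊎ y < x)
    +-monoʳ-<            : ∀ x {y z} → y < z → x + y < x + z
    *-pos                : ∀ {x y} → 0# < x → 0# < y → 0# < x * y

  open IsStrictPartialOrder isStrictPartialOrder public
    using (<-resp-≈; <-respʳ-≈; <-respˡ-≈)
    renaming (irrefl to <-irrefl; trans to <-trans)

  commutativeRing : CommutativeRing c ℓ₁
  commutativeRing = record { isCommutativeRing = isCommutativeRing }

  open RawMonoidDefs (CommutativeRing.+-rawMonoid commutativeRing) public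
    using (sum)

  _≤_ : Rel ℝ ℓ₃
  x ≤ y = ¬ (y < x)

  -- |x - y| < e
  Within : ℝ → ℝ → ℝ → Set ℓ₃
  Within e x y = (x - y < e) × (y - x < e)

  fromℕ : ℕ → ℝ
  fromℕ n = sum {n} (λ _ → 1#)

  ConvergesTo : (ℕ → ℝ) → ℝ → Set (c ⊔ ℓ₃)
  ConvergesTo s l = ∀ e → 0# < e → ∃[ N ] (∀ m → N ℕ.≤ m → Within e (s m) l)

  Cauchy : (ℕ → ℝ) → Set (c ⊔ ℓ₃)
  Cauchy s = ∀ e → 0# < e →
    ∃[ N ] (∀ m k → N ℕ.≤ m → N ℕ.≤ k → Within e (s m) (s k))

  SumsTo : (ℕ → ℝ) → ℝ → Set (c ⊔ ℓ₃)
  SumsTo a = ConvergesTo (λ N → sum {N} (λ k → a (toℕ k)))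

  recip : ∀ {x} → x # 0# → ℝ
  recip x#0 = proj₁ (#⇒invertible x#0)

record RealNumbers (c ℓ₁ ℓ₂ ℓ₃ : Level) : Set (lsuc (c ⊔ ℓ₁ ⊔ ℓ₂ ⊔ ℓ₃)) where
  field
    orderedField : OrderedField c ℓ₁ ℓ₂ ℓ₃

  open OrderedField orderedField public

  field
    archimedean : ∀ x → ∃[ n ] (x < fromℕ n)
    complete    : ∀ s → Cauchy s → ∃[ l ] ConvergesTo s l


module Matrices {c ℓ₁ ℓ₂ ℓ₃} (𝓡 : RealNumbers c ℓ₁ ℓ₂ ℓ₃) where
  open RealNumbers 𝓡

  Matrix : ℕ → ℕ → Set c
  Matrix m n = Fin m → Fin n → ℝ

  infix  4 _≋_
  infixl 6 _⊖_
  infixl 7 _·_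
  infix  9 _ᵀ

  _≋_ : ∀ {m n} → Rel (Matrix m n) ℓ₁
  A ≋ B = ∀ a b → A a b ≈ B a b

  I : ∀ {m} → Matrix m m
  I a b = if does (a ≟ b) then 1# else 0#

  O : ∀ {m n} → Matrix m n
  O _ _ = 0#

  _·_ : ∀ {m n p} → Matrix m n → Matrix n p → Matrix m p
  (A · B) a b = sum (λ k → A a k * B k b)

  _⊖_ : ∀ {m n} → Matrix m n → Matrix m n → Matrix m n
  (A ⊖ B) a b = A a b - B a b

  scale : ∀ {m n} → ℝ → Matrix m n → Matrix m n
  scale r A a b = r * A a b

  _ᵀ : ∀ {m n} → Matrix m n → Matrix n m
  (A ᵀ) a b = A b a

  Invertible : ∀ {m} → Matrix m m → Set (c ⊔ ℓ₁)
  Invertible {m} = AlgDefs.Invertible (_≋_ {m} {m}) I _·_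

  Orthogonal : ∀ {m} → Matrix m m → Set ℓ₁
  Orthogonal A = (A · A ᵀ ≋ I) × (A ᵀ · A ≋ I)

  Symmetric : ∀ {m} → Matrix m m → Set ℓ₁
  Symmetric A = A ᵀ ≋ A

  quadraticForm : ∀ {m} → Matrix m m → Vector ℝ m → ℝ
  quadraticForm A x = sum (λ a → sum (λ b → x a * A a b * x b))

  NonZeroVector : ∀ {m} → Vector ℝ m → Set ℓ₂
  NonZeroVector x = ∃[ a ] (x a # 0#)

  PositiveDefinite : ∀ {m} → Matrix m m → Set (c ⊔ ℓ₁ ⊔ ℓ₂ ⊔ ℓ₃)
  PositiveDefinite A =
    Symmetric A × (∀ x → NonZeroVector x → 0# < quadraticForm A x)


module Graphs {c ℓ₁ ℓ₂ ℓ₃} (𝓡 : RealNumbers c ℓ₁ ℓ₂ ℓ₃) where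
  open RealNumbers 𝓡
  open Matrices 𝓡

  -- There are at least two vertices, as otherwise deg is 0 and the transition
  -- probabilities w i j / deg i are meaningless.

  record WeightedGraph (n : ℕ) : Set (lsuc 0ℓ ⊔ c ⊔ ℓ₁ ⊔ ℓ₃) where
    infix 4 _~_ _~?_
    field
      2≤n         : 2 ℕ.≤ n
      _~_         : Rel (Fin n) 0ℓ
      _~?_        : Decidable _~_
      loopless    : ∀ i → ¬ (i ~ i)
      w           : Fin n → Fin n → ℝ
      w-symmetric : ∀ i j → w i j ≈ w j i
      w-nonneg    : ∀ i j → 0# ≤ w i j
      w-positive  : ∀ i j → 0# < w i j ⇔ i ~ j
      connected   : ∀ i j → Star _~_ i j

    deg : Fin n → ℝ
    deg i = sum (λ j → w i j)

  -- The last field forces σ e to depend only on the endpoints of e.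

  record ConnectionGraph (n d : ℕ) : Set (lsuc 0ℓ ⊔ c ⊔ ℓ₁ ⊔ ℓ₃) where
    field
      graph : WeightedGraph n
    open WeightedGraph graph public
    field
      σ            : ∀ {i j} → i ~ j → Matrix d d
      σ-orthogonal : ∀ {i j} (e : i ~ j) → Orthogonal (σ e)
      σ-transpose  : ∀ {i j} (e : i ~ j) (e′ : j ~ i) → σ e′ ≋ (σ e) ᵀ


-- Positivity of the degrees, which makes the transition probabilities
-- well defined.

module Degrees {c ℓ₁ ℓ₂ ℓ₃} (𝓡 : RealNumbers c ℓ₁ ℓ₂ ℓ₃) where
  open RealNumbers 𝓡
  open Graphs 𝓡

  <-cotrans : ∀ {x y} → x < y → ∀ z → x < z ⊎ z < y
  <-cotrans {x} {y} x<y z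
    with #-cotrans (Equivalence.from #⇔<⊎> (inj₁ x<y)) z
  ... | inj₁ x#z with Equivalence.to #⇔<⊎> x#z
  ...   | inj₁ x<z = inj₁ x<z
  ...   | inj₂ z<x = inj₂ (<-trans z<x x<y)
  <-cotrans {x} {y} x<y z | inj₂ z#y with Equivalence.to #⇔<⊎> z#y
  ...   | inj₁ z<y = inj₂ z<y
  ...   | inj₂ y<z = inj₁ (<-trans x<y y<z)

  pos+nonneg : ∀ {x y} → 0# < x → 0# ≤ y → 0# < x + y
  pos+nonneg {x} {y} 0<x 0≤y with <-cotrans 0<x (x + y)
  ... | inj₁ 0<x+y = 0<x+y
  ... | inj₂ x+y<x = ⊥-elim (0≤y
    (<-respʳ-≈ (-‿inverseˡ x)
      (<-respˡ-≈ (trans (sym (+-assoc _ _ _))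
                        (trans (+-congʳ (-‿inverseˡ x)) (+-identityˡ y)))
        (+-monoʳ-< (- x) x+y<x))))

  nonneg+pos : ∀ {x y} → 0# ≤ x → 0# < y → 0# < x + y
  nonneg+pos 0≤x 0<y = <-respʳ-≈ (+-comm _ _) (pos+nonneg 0<y 0≤x)

  nonneg+nonneg : ∀ {x y} → 0# ≤ x → 0# ≤ y → 0# ≤ x + y
  nonneg+nonneg {x} {y} 0≤x 0≤y x+y<0 with <-cotrans x+y<0 y
  ... | inj₂ y<0   = 0≤y y<0
  ... | inj₁ x+y<y = 0≤x
    (<-respʳ-≈ (-‿inverseˡ y)
      (<-respˡ-≈ (trans (+-congˡ (+-comm x y)) (trans (sym (+-assoc _ _ _))
                        (trans (+-congʳ (-‿inverseˡ y)) (+-identityˡ x))))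
        (+-monoʳ-< (- y) x+y<y)))

  sum-nonneg : ∀ {n} (f : Vector ℝ n) → (∀ i → 0# ≤ f i) → 0# ≤ sum f
  sum-nonneg {zero}  f 0≤f = <-irrefl refl
  sum-nonneg {suc n} f 0≤f =
    nonneg+nonneg (0≤f zero) (sum-nonneg (λ i → f (suc i)) (λ i → 0≤f (suc i)))

  sum-pos : ∀ {n} (f : Vector ℝ n) → (∀ i → 0# ≤ f i) →
            ∀ i → 0# < f i → 0# < sum f
  sum-pos f 0≤f zero    0<fi =
    pos+nonneg 0<fi (sum-nonneg (λ i → f (suc i)) (λ i → 0≤f (suc i)))
  sum-pos f 0≤f (suc i) 0<fi =
    nonneg+pos (0≤f zero)
      (sum-pos (λ i → f (suc i)) (λ i → 0≤f (suc i)) i 0<fi)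

  module _ {n} (G : WeightedGraph n) where
    open WeightedGraph G

    neighbour : ∀ i → ∃[ j ] (i ~ j)
    neighbour = go 2≤n connected
      where
      go : ∀ {n} {R : Rel (Fin n) 0ℓ} → 2 ℕ.≤ n →
           (∀ i j → Star R i j) → ∀ i → ∃[ j ] R i j
      go (s≤s (s≤s _)) conn i
        with punchIn i zero | punchInᵢ≢i i zero | conn i (punchIn i zero)
      ... | _ | j≢i | ε     = ⊥-elim (j≢i ≡.refl)
      ... | _ | _   | e ◅ _ = _ , e

    deg-pos : ∀ i → 0# < deg i
    deg-pos i with j , i~j ← neighbour i =
      sum-pos (w i) (w-nonneg i) j (Equivalence.from (w-positive i j) i~j)

    deg#0 : ∀ i → deg i # 0#
    deg#0 i = Equivalence.from #⇔<⊎> (inj₂ (deg-pos i))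


module Connection {c ℓ₁ ℓ₂ ℓ₃} (𝓡 : RealNumbers c ℓ₁ ℓ₂ ℓ₃)
  {n d : ℕ} (Γ : Graphs.ConnectionGraph 𝓡 n d) where
  open RealNumbers 𝓡
  open Matrices 𝓡
  open Graphs 𝓡
  open ConnectionGraph Γ
  open Degrees 𝓡 using (deg#0)

  -- The connection on all pairs of vertices, set to O off the edges.

  σ₀ : Fin n → Fin n → Matrix d d
  σ₀ i j with i ~? j
  ... | yes e = σ e
  ... | no  _ = O

  laplacianBlock : Fin n → Fin n → Matrix d d
  laplacianBlock i j =
    if does (i ≟ j) then scale (deg i) I else scale (- w i j) (σ₀ i j)

  -- remQuot d sends the index i * d + a to the block i and position a.

  connectionLaplacian : Matrix (n ℕ.* d) (n ℕ.* d)
  connectionLaplacian r s =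
    let (i , a) = remQuot {n} d r
        (j , b) = remQuot {n} d s
    in laplacianBlock i j a b

  AbsolutelyInconsistent : Set (c ⊔ ℓ₁)
  AbsolutelyInconsistent = Invertible connectionLaplacian

  p : Fin n → Fin n → ℝ
  p i j = w i j * recip (deg#0 graph i)

  -- A vector x₁ ∷ … ∷ xₖ ∷ [] is an outcome of (X₁ , … , Xₖ).

  pathProbability : ∀ {k} → Fin n → Vec (Fin n) k → ℝ
  pathProbability i []       = 1#
  pathProbability i (x ∷ xs) = p i x * pathProbability x xs

  -- Steps along non-edges contribute O, but have probability 0.

  pathHolonomy : ∀ {k} → Fin n → Vec (Fin n) k → Matrix d d
  pathHolonomy i []       = I
  pathHolonomy i (x ∷ xs) = σ₀ i x · pathHolonomy x xs

  sumPaths : ∀ k → (Vec (Fin n) k → ℝ) → ℝ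
  sumPaths zero    F = F []
  sumPaths (suc k) F = sum (λ x → sumPaths k (λ xs → F (x ∷ xs)))

  -- 𝔼[ F (X₁ , … , Xₖ) ∣ X₀ = i ]

  𝔼 : Fin n → ∀ {k} → (Vec (Fin n) k → ℝ) → ℝ
  𝔼 i {k} F = sumPaths k (λ xs → pathProbability i xs * F xs)

  -- The event T¹ᵢ = k + 1, which is determined by X₁ , … , Xₖ₊₁.

  FirstReturn : ∀ {k} → Fin n → Vec (Fin n) (suc k) → Set
  FirstReturn i xs = All (_≢ i) (init xs) × last xs ≡ i

  firstReturn? : ∀ {k} i (xs : Vec (Fin n) (suc k)) → Dec (FirstReturn i xs)
  firstReturn? i xs = all? (λ x → ¬? (x ≟ i)) (init xs) ×-dec (last xs ≟ i)

  onFirstReturn : ∀ {k} → Fin n →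
                  (Vec (Fin n) (suc k) → ℝ) → Vec (Fin n) (suc k) → ℝ
  onFirstReturn i F xs = if does (firstReturn? i xs) then F xs else 0#

  ReturnsAlmostSurely : Fin n → Set (c ⊔ ℓ₃)
  ReturnsAlmostSurely i =
    SumsTo (λ k → 𝔼 i {suc k} (onFirstReturn i (λ _ → 1#))) 1#

  -- Ω is the expectation of the ordered product of σ along the walk from i up
  -- to time T¹ᵢ.  This random matrix is defined almost surely, and has entries
  -- bounded by 1 in absolute value, so that its expectation is the (absolutely
  -- convergent) sum of the contributions of the events T¹ᵢ = k + 1.

  IsMeanReturnHolonomy : Fin n → Matrix d d → Set (c ⊔ ℓ₃)
  IsMeanReturnHolonomy i Ω =
    ReturnsAlmostSurely i ×
    (∀ a b → SumsTo
      (λ k → 𝔼 i {suc k} (onFirstReturn i (λ xs → pathHolonomy i xs a b)))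
      (Ω a b))

{-# OPTIONS --safe #-}

-- Fix a vertex i and let H(x) be the mean holonomy of the walk from x up to the
-- time it hits i, with H(i) = I. First-step analysis says that H is harmonic off
-- i, and at i that L H = deg(i) (I - Ω), so that Hᵀ L H = deg(i) (I - Ω).
-- Hence I - Ω is symmetric, and it is positive definite once L is: L is positive
-- semidefinite with 2⟨Φ, L Φ⟩ = Σ w(x,y) |Φ(x) - σ(x,y) Φ(y)|², and this energy
-- is positive as soon as some entry of L Φ is nonzero, which for invertible L
-- holds for all nonzero Φ. Conversely, positive definite matrices are invertible,
-- and the columns of H (I - Ω)⁻¹ / deg(i), for all i, form a right inverse of L,
-- hence an inverse by symmetry.
--
-- The series converge with the explicit rate of the probabilities of not yet
-- having hit i, which makes the argument constructive.

module Submission where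

open import Defs
open import Algebra.Bundles using (CommutativeRing; RawRing)
import Algebra.Apartness.Properties.HeytingCommutativeRing as HeytingProperties
import Algebra.Properties.AbelianGroup as AbelianGroupProperties
import Algebra.Properties.Ring as RingProperties
import Algebra.Properties.Semiring.Mult.TCOptimised as SemiringMult
import Algebra.Properties.Semiring.Sum as SemiringSum
import Algebra.Solver.Ring as RingSolver
open import Algebra.Solver.Ring.AlmostCommutativeRing using (fromCommutativeRing; _-Raw-AlmostCommutative⟶_)
open import Data.Bool.Base using (Bool; true; false; if_then_else_)
open import Data.Empty using (⊥-elim)
open import Data.Fin.Base using (Fin; zero; suc; toℕ; combine; remQuot; _↑ˡ_; _↑ʳ_)
open import Data.Fin.Properties using (_≟_; remQuot-combine; combine-remQuot)
open import Data.Maybe.Base using (Maybe; just; nothing)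
open import Data.Nat.Base as ℕ using (ℕ; zero; suc)
import Data.Nat.Properties as ℕ
open import Data.Product.Base using (_×_; _,_; proj₁; proj₂; Σ-syntax; ∃-syntax)
open import Data.Sum.Base using (_⊎_; inj₁; inj₂)
open import Data.Vec.Base using (Vec; []; _∷_)
open import Data.Vec.Functional using () renaming (_∷_ to _∷ᵛ_)
open import Function.Bundles using (_⇔_; Equivalence; mk⇔)
open import Level using (0ℓ; _⊔_)
open import Relation.Binary.Construct.Closure.ReflexiveTransitive using (Star; ε; _◅_)
open import Relation.Binary.Core using (Rel)
open import Relation.Binary.PropositionalEquality.Core as ≡ using (_≡_)
import Relation.Binary.Reasoning.Setoid as SetoidReasoning
open import Relation.Nullary.Decidable using (yes; no; does)
open import Relation.Nullary.Negation using (¬_)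

-- The pair (a , b) stands for the integer a - b; keeping one component 0 makes
-- equal coefficients identical, so that the solver can cancel.

-- The order is constructive: `x ≤ y` is the negation of `y < x`, and no number can be tested for
-- being zero. The familiar argument for positivity, that vanishing energy forces a section into the
-- kernel of the Laplacian, would only show that the energy is not zero. It is replaced by a direct
-- search: a sum apart from zero has a summand apart from zero, and a product passes apartness on to
-- its factors, so a nonzero entry of L Φ leads to one edge and one coordinate whose contribution to
-- the energy is strictly positive. Square roots and absolute values are avoided as well: a norm
-- bound |v| ≤ q becomes a family of inequalities linear in v, one for each test vector, and |a| ≤ b
-- becomes a pair of inequalities. The decay rate is m / (m + j) instead of a geometric one because,
-- with denominators cleared, it follows by an induction that adds two inequalities.

module IntegerCoefficientSolver {c ℓ} (R : CommutativeRing c ℓ) where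
  open CommutativeRing R hiding (zero)
  open SetoidReasoning setoid
  open RingProperties ring using (-0#≈0#; -‿distribˡ-*; -‿distribʳ-*)
  open AbelianGroupProperties +-abelianGroup using (⁻¹-∙-comm; ⁻¹-involutive)
  open SemiringMult semiring renaming (_×_ to _×′_) using (×-homo-+; ×1-homo-*; 1+×)

  private
    difference : ℕ → ℕ → ℕ × ℕ
    difference zero    b       = zero , b
    difference (suc a) zero    = suc a , zero
    difference (suc a) (suc b) = difference a b

    coefficients : RawRing _ _
    coefficients = record
      { Carrier = ℕ × ℕ
      ; _≈_ = _≡_
      ; _+_ = λ (a , b) (a′ , b′) → difference (a ℕ.+ a′) (b ℕ.+ b′)
      ; _*_ = λ (a , b) (a′ , b′) → difference (a ℕ.* a′ ℕ.+ b ℕ.* b′) (a ℕ.* b′ ℕ.+ b ℕ.* a′)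
      ; -_  = λ (a , b) → b , a
      ; 0#  = 0 , 0
      ; 1#  = 1 , 0
      }

    -- In the optimised multiple `1 ×′ x` reduces to `x`, so `ι 1` is `1#` itself and not a sum with
    -- `0#`.
    ι : ℕ → Carrier
    ι a = a ×′ 1#

    -- The first clause makes the literals 0 and 1 evaluate to 0# and 1#.
    eval : ℕ × ℕ → Carrier
    eval (a , zero)  = ι a
    eval (a , suc b) = ι a - ι (suc b)

    eval-difference : ∀ a b → eval (a , b) ≈ ι a - ι b
    eval-difference a zero    = sym (trans (+-congˡ -0#≈0#) (+-identityʳ _))
    eval-difference a (suc b) = refl

    interchange : ∀ x y z w → (x + y) + (z + w) ≈ (x + z) + (y + w)
    interchange x y z w = begin
      (x + y) + (z + w) ≈⟨ +-assoc x y _ ⟩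
      x + (y + (z + w)) ≈⟨ +-congˡ (+-assoc y z w) ⟨
      x + ((y + z) + w) ≈⟨ +-congˡ (+-congʳ (+-comm y z)) ⟩
      x + ((z + y) + w) ≈⟨ +-congˡ (+-assoc z y w) ⟩
      x + (z + (y + w)) ≈⟨ +-assoc x z _ ⟨
      (x + z) + (y + w) ∎

    cancel : ∀ x y z → (x + y) - (x + z) ≈ y - z
    cancel x y z = begin
      (x + y) - (x + z)       ≈⟨ +-congˡ (⁻¹-∙-comm x z) ⟨
      (x + y) + (- x - z)     ≈⟨ interchange x y (- x) (- z) ⟩
      (x - x) + (y - z)       ≈⟨ +-congʳ (-‿inverseʳ x) ⟩
      0# + (y - z)            ≈⟨ +-identityˡ _ ⟩
      y - z                   ∎

    difference-homo : ∀ a b → eval (difference a b) ≈ ι a - ι b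
    difference-homo zero    b       = eval-difference zero b
    difference-homo (suc a) zero    = eval-difference (suc a) zero
    difference-homo (suc a) (suc b) = begin
      eval (difference a b)       ≈⟨ difference-homo a b ⟩
      ι a - ι b                   ≈⟨ cancel 1# (ι a) (ι b) ⟨
      (1# + ι a) - (1# + ι b)     ≈⟨ +-cong (1+× a 1#) (-‿cong (1+× b 1#)) ⟨
      ι (suc a) - ι (suc b)       ∎

    eval-+ : ∀ x y → eval (RawRing._+_ coefficients x y) ≈ eval x + eval y
    eval-+ (a , b) (a′ , b′) = begin
      eval (difference (a ℕ.+ a′) (b ℕ.+ b′)) ≈⟨ difference-homo (a ℕ.+ a′) (b ℕ.+ b′) ⟩
      ι (a ℕ.+ a′) - ι (b ℕ.+ b′)             ≈⟨ +-cong (×-homo-+ 1# a a′) (-‿cong (×-homo-+ 1# b b′)) ⟩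
      (ι a + ι a′) - (ι b + ι b′)             ≈⟨ +-congˡ (⁻¹-∙-comm _ _) ⟨
      (ι a + ι a′) + (- ι b - ι b′)           ≈⟨ interchange _ _ _ _ ⟩
      (ι a - ι b) + (ι a′ - ι b′)             ≈⟨ +-cong (eval-difference a b) (eval-difference a′ b′) ⟨
      eval (a , b) + eval (a′ , b′)           ∎

    ι-*+* : ∀ a b c d → ι (a ℕ.* b ℕ.+ c ℕ.* d) ≈ ι a * ι b + ι c * ι d
    ι-*+* a b c d = trans (×-homo-+ 1# (a ℕ.* b) _) (+-cong (×1-homo-* a b) (×1-homo-* c d))

    eval-* : ∀ x y → eval (RawRing._*_ coefficients x y) ≈ eval x * eval y
    eval-* (a , b) (a′ , b′) = begin
      eval (difference (a ℕ.* a′ ℕ.+ b ℕ.* b′) (a ℕ.* b′ ℕ.+ b ℕ.* a′))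
        ≈⟨ difference-homo (a ℕ.* a′ ℕ.+ b ℕ.* b′) _ ⟩
      ι (a ℕ.* a′ ℕ.+ b ℕ.* b′) - ι (a ℕ.* b′ ℕ.+ b ℕ.* a′)
        ≈⟨ +-cong (ι-*+* a a′ b b′) (-‿cong (ι-*+* a b′ b a′)) ⟩
      (A * A′ + B * B′) - (A * B′ + B * A′)
        ≈⟨ +-congˡ (⁻¹-∙-comm _ _) ⟨
      (A * A′ + B * B′) + (- (A * B′) - (B * A′))
        ≈⟨ +-congˡ (+-comm _ _) ⟩
      (A * A′ + B * B′) + (- (B * A′) - (A * B′))
        ≈⟨ interchange _ _ _ _ ⟩
      (A * A′ - B * A′) + (B * B′ - A * B′)
        ≈⟨ +-congˡ (+-comm _ _) ⟩
      (A * A′ - B * A′) + (- (A * B′) + B * B′)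
        ≈⟨ +-cong (+-congˡ (-‿distribˡ-* B A′)) (+-cong (-‿distribʳ-* A B′) neg*neg) ⟩
      (A * A′ + - B * A′) + (A * - B′ + - B * - B′)
        ≈⟨ +-cong (distribʳ A′ A (- B)) (distribʳ (- B′) A (- B)) ⟨
      (A - B) * A′ + (A - B) * - B′
        ≈⟨ distribˡ (A - B) A′ (- B′) ⟨
      (A - B) * (A′ - B′)
        ≈⟨ *-cong (eval-difference a b) (eval-difference a′ b′) ⟨
      eval (a , b) * eval (a′ , b′) ∎
      where
      A  = ι a
      B  = ι b
      A′ = ι a′
      B′ = ι b′
      neg*neg : B * B′ ≈ - B * - B′
      neg*neg = begin
        B * B′         ≈⟨ ⁻¹-involutive _ ⟨
        - - (B * B′)   ≈⟨ -‿cong (-‿distribʳ-* B B′) ⟩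
        - (B * - B′)   ≈⟨ -‿distribˡ-* B _ ⟩
        - B * - B′     ∎

    eval-neg : ∀ x → eval (RawRing.-_ coefficients x) ≈ - eval x
    eval-neg (a , b) = begin
      eval (b , a)       ≈⟨ eval-difference b a ⟩
      ι b - ι a          ≈⟨ +-comm _ _ ⟩
      - ι a + ι b        ≈⟨ +-congˡ (⁻¹-involutive _) ⟨
      - ι a - (- ι b)    ≈⟨ ⁻¹-∙-comm _ _ ⟩
      - (ι a - ι b)      ≈⟨ -‿cong (eval-difference a b) ⟨
      - eval (a , b)     ∎

    morphism : coefficients -Raw-AlmostCommutative⟶ fromCommutativeRing R
    morphism = record
      { ⟦_⟧    = eval
      ; +-homo = eval-+
      ; *-homo = eval-*
      ; -‿homo = eval-neg
      ; 0-homo = refl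
      ; 1-homo = refl
      }

    -- Only representatives are compared, as equality in `R` may be undecidable. An answer `nothing`
    -- can make the solver fail but never makes it unsound.
    _coeff≟_ : ∀ x y → Maybe (eval x ≈ eval y)
    (a , b) coeff≟ (a′ , b′) with a ℕ.≟ a′ | b ℕ.≟ b′
    ... | yes ≡.refl | yes ≡.refl = just refl
    ... | _          | _          = nothing

  open RingSolver coefficients (fromCommutativeRing R) morphism _coeff≟_ public
    using (Polynomial; solve; con; _:+_; _:*_; _:-_; :-_; _:=_)

  0:  : ∀ {m} → Polynomial m
  0: = con (0 , 0)

  1:  : ∀ {m} → Polynomial m
  1: = con (1 , 0)

-- Order and apartness in a constructive ordered field.

module OrderedFieldProperties {c ℓ₁ ℓ₂ ℓ₃} (𝓡 : RealNumbers c ℓ₁ ℓ₂ ℓ₃) where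
  open RealNumbers 𝓡
  open Degrees 𝓡 public using (<-cotrans; pos+nonneg; nonneg+pos; nonneg+nonneg; sum-nonneg; sum-pos)
  open HeytingProperties heytingCommutativeRing public using (#-congʳ; x-0≈x; 1#0)
  open IntegerCoefficientSolver commutativeRing public

  <⇒0<- : ∀ {x y} → x < y → 0# < y - x
  <⇒0<- {x} {y} x<y = <-respʳ-≈ (+-comm (- x) y) (<-respˡ-≈ (-‿inverseˡ x) (+-monoʳ-< (- x) x<y))

  0<-⇒< : ∀ {x y} → 0# < y - x → x < y
  0<-⇒< {x} {y} 0<y-x =
    <-respʳ-≈ (solve 2 (λ a b → a :+ (b :- a) := b) refl x y)
      (<-respˡ-≈ (+-identityʳ x) (+-monoʳ-< x 0<y-x))

  -<0⇒< : ∀ {x y} → x - y < 0# → x < y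
  -<0⇒< {x} {y} x-y<0 =
    0<-⇒< (<-respʳ-≈ (solve 2 (λ a b → 0: :- (a :- b) := b :- a) refl x y) (<⇒0<- x-y<0))

  <⇒-<0 : ∀ {x y} → x < y → x - y < 0#
  <⇒-<0 {x} {y} x<y =
    0<-⇒< (<-respʳ-≈ (solve 2 (λ a b → b :- a := 0: :- (a :- b)) refl x y) (<⇒0<- x<y))

  <⇒≤ : ∀ {x y} → x < y → x ≤ y
  <⇒≤ x<y y<x = <-irrefl refl (<-trans x<y y<x)

  ≤-reflexive : ∀ {x y} → x ≈ y → x ≤ y
  ≤-reflexive x≈y y<x = <-irrefl (sym x≈y) y<x

  <-≤-trans : ∀ {x y z} → x < y → y ≤ z → x < z
  <-≤-trans {z = z} x<y y≤z with <-cotrans x<y z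
  ... | inj₁ x<z = x<z
  ... | inj₂ z<y = ⊥-elim (y≤z z<y)

  ≤-<-trans : ∀ {x y z} → x ≤ y → y < z → x < z
  ≤-<-trans {x} x≤y y<z with <-cotrans y<z x
  ... | inj₁ y<x = ⊥-elim (x≤y y<x)
  ... | inj₂ x<z = x<z

  ≤-trans : ∀ {x y z} → x ≤ y → y ≤ z → x ≤ z
  ≤-trans x≤y y≤z z<x = y≤z (<-≤-trans z<x x≤y)

  ≤-respʳ : ∀ {x y z} → y ≈ z → x ≤ y → x ≤ z
  ≤-respʳ y≈z x≤y z<x = x≤y (<-respˡ-≈ (sym y≈z) z<x)

  ≤-respˡ : ∀ {x y z} → y ≈ z → y ≤ x → z ≤ x
  ≤-respˡ y≈z y≤x x<z = y≤x (<-respʳ-≈ (sym y≈z) x<z)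

  ≤-antisym : ∀ {x y} → x ≤ y → y ≤ x → x ≈ y
  ≤-antisym {x} {y} x≤y y≤x = proj₁ (tight x y) λ x#y → case (Equivalence.to #⇔<⊎> x#y)
    where
    case : ¬ (x < y ⊎ y < x)
    case (inj₁ x<y) = y≤x x<y
    case (inj₂ y<x) = x≤y y<x

  ≤⇒0≤- : ∀ {x y} → x ≤ y → 0# ≤ y - x
  ≤⇒0≤- x≤y y-x<0 = x≤y (-<0⇒< y-x<0)

  0≤-⇒≤ : ∀ {x y} → 0# ≤ y - x → x ≤ y
  0≤-⇒≤ 0≤y-x y<x = 0≤y-x (<⇒-<0 y<x)

  +-mono-≤ : ∀ {x y z w} → x ≤ y → z ≤ w → x + z ≤ y + w
  +-mono-≤ {x} {y} {z} {w} x≤y z≤w = 0≤-⇒≤ (≤-respʳ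
    (solve 4 (λ x y z w → (y :- x) :+ (w :- z) := (y :+ w) :- (x :+ z)) refl x y z w)
    (nonneg+nonneg (≤⇒0≤- x≤y) (≤⇒0≤- z≤w)))

  +-mono-< : ∀ {x y z w} → x < y → z < w → x + z < y + w
  +-mono-< {x} {y} {z} {w} x<y z<w = 0<-⇒< (<-respʳ-≈
    (solve 4 (λ x y z w → (y :- x) :+ (w :- z) := (y :+ w) :- (x :+ z)) refl x y z w)
    (pos+nonneg (<⇒0<- x<y) (<⇒≤ (<⇒0<- z<w))))

  sum-mono-≤ : ∀ {n} (f g : Fin n → ℝ) → (∀ i → f i ≤ g i) → sum f ≤ sum g
  sum-mono-≤ {zero}  f g f≤g = ≤-reflexive refl
  sum-mono-≤ {suc n} f g f≤g =
    +-mono-≤ (f≤g zero) (sum-mono-≤ (λ i → f (suc i)) (λ i → g (suc i)) (λ i → f≤g (suc i)))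

  pos⇒# : ∀ {x} → 0# < x → x # 0#
  pos⇒# 0<x = Equivalence.from #⇔<⊎> (inj₂ 0<x)

  recip-inverseʳ : ∀ {x} (x#0 : x # 0#) → x * recip x#0 ≈ 1#
  recip-inverseʳ {x} x#0 =
    trans (*-congʳ (sym (x-0≈x x))) (proj₂ (proj₂ (#⇒invertible x#0)))

  *-cancelˡ : ∀ {x y z} → x # 0# → x * y ≈ x * z → y ≈ z
  *-cancelˡ {x} {y} {z} x#0 xy≈xz = trans (sym (unscale y)) (trans (*-congˡ xy≈xz) (unscale z))
    where
    unscale : ∀ y → recip x#0 * (x * y) ≈ y
    unscale y = trans (solve 3 (λ r x y → r :* (x :* y) := (x :* r) :* y) refl (recip x#0) x y)
      (trans (*-congʳ (recip-inverseʳ x#0)) (*-identityˡ y))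

  -- Apartness from `0#` amounts to invertibility, and if `r` inverts `x * y` then `r * y` inverts
  -- `x`.
  *#0⇒#0ˡ : ∀ {x y} → x * y # 0# → x # 0#
  *#0⇒#0ˡ {x} {y} xy#0 = invertible⇒# (r * y , trans (*-comm _ _) inverse , inverse)
    where
    r = recip xy#0
    inverse : (x - 0#) * (r * y) ≈ 1#
    inverse = trans (solve 3 (λ x y r → (x :- 0:) :* (r :* y) := (x :* y) :* r) refl x y r)
      (recip-inverseʳ xy#0)

  *#0⇒#0ʳ : ∀ {x y} → x * y # 0# → y # 0#
  *#0⇒#0ʳ xy#0 = *#0⇒#0ˡ (#-congʳ (*-comm _ _) xy#0)

  -- Cotransitivity at `y` supplies the disjunction. In its first case `x + y` is apart from `y`, so
  -- their difference, which equals `x`, is invertible.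
  +#0⇒#0⊎#0 : ∀ {x y} → x + y # 0# → x # 0# ⊎ y # 0#
  +#0⇒#0⊎#0 {x} {y} x+y#0 with #-cotrans x+y#0 y
  ... | inj₂ y#0 = inj₂ y#0
  ... | inj₁ x+y#y with #⇒invertible x+y#y
  ... | r , rx≈1 , xr≈1 = inj₁ (invertible⇒# (r , trans (*-congˡ eq) rx≈1 , trans (*-congʳ eq) xr≈1))
    where
    eq : x - 0# ≈ (x + y) - y
    eq = solve 2 (λ x y → x :- 0: := (x :+ y) :- y) refl x y

  -- This is how a witness is found without zero tests: it locates the edge in `energy-pos` and the
  -- entry of L Φ in `absolutelyInconsistent⇒energy-pos`.
  sum#0⇒term#0 : ∀ {n} (f : Fin n → ℝ) → sum f # 0# → ∃[ i ] (f i # 0#)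
  sum#0⇒term#0 {zero}  f 0#0 = ⊥-elim (#-irrefl refl 0#0)
  sum#0⇒term#0 {suc n} f f#0 with +#0⇒#0⊎#0 f#0
  ... | inj₁ f₀#0 = zero , f₀#0
  ... | inj₂ rest with sum#0⇒term#0 (λ i → f (suc i)) rest
  ...   | i , fᵢ#0 = suc i , fᵢ#0

  #0∧nonneg⇒pos : ∀ {x} → x # 0# → 0# ≤ x → 0# < x
  #0∧nonneg⇒pos x#0 0≤x with Equivalence.to #⇔<⊎> x#0
  ... | inj₁ x<0 = ⊥-elim (0≤x x<0)
  ... | inj₂ 0<x = 0<x

  #0⇒0<square : ∀ {x} → x # 0# → 0# < x * x
  #0⇒0<square {x} x#0 with Equivalence.to #⇔<⊎> x#0
  ... | inj₂ 0<x = *-pos 0<x 0<x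
  ... | inj₁ x<0 = <-respʳ-≈ (solve 1 (λ x → (0: :- x) :* (0: :- x) := x :* x) refl x)
    (*-pos (<⇒0<- x<0) (<⇒0<- x<0))

  -- The sign of `x` cannot be decided outright, but assuming `x * x < 0#` makes the product apart
  -- from zero, hence `x` too, and then the square is positive after all.
  0≤square : ∀ x → 0# ≤ x * x
  0≤square x x²<0 = <⇒≤ (#0⇒0<square (*#0⇒#0ˡ (Equivalence.from #⇔<⊎> (inj₁ x²<0)))) x²<0

  *-nonneg : ∀ {x y} → 0# ≤ x → 0# ≤ y → 0# ≤ x * y
  *-nonneg {x} {y} 0≤x 0≤y xy<0 =
    <⇒≤ (*-pos (#0∧nonneg⇒pos (*#0⇒#0ˡ xy#0) 0≤x) (#0∧nonneg⇒pos (*#0⇒#0ʳ xy#0) 0≤y)) xy<0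
    where
    xy#0 = Equivalence.from #⇔<⊎> (inj₁ xy<0)

  0<1 : 0# < 1#
  0<1 = <-respʳ-≈ (*-identityˡ 1#) (#0⇒0<square 1#0)

  *-monoʳ-≤ : ∀ {x y z} → 0# ≤ z → x ≤ y → z * x ≤ z * y
  *-monoʳ-≤ {x} {y} {z} 0≤z x≤y = 0≤-⇒≤ (≤-respʳ
    (solve 3 (λ x y z → z :* (y :- x) := z :* y :- z :* x) refl x y z)
    (*-nonneg 0≤z (≤⇒0≤- x≤y)))

  recip-pos : ∀ {x} (0<x : 0# < x) → 0# < recip (pos⇒# 0<x)
  recip-pos {x} 0<x = <-respʳ-≈ eq (*-pos 0<x (#0⇒0<square r#0))
    where
    r = recip (pos⇒# 0<x)
    xr≈1 = recip-inverseʳ (pos⇒# 0<x)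
    r#0 : r # 0#
    r#0 = *#0⇒#0ʳ (#-congʳ (sym xr≈1) 1#0)
    eq : x * (r * r) ≈ r
    eq = trans (sym (*-assoc x r r)) (trans (*-congʳ xr≈1) (*-identityˡ r))

  *-cancelˡ-pos : ∀ {x y} → 0# < x → 0# < x * y → 0# < y
  *-cancelˡ-pos {x} {y} 0<x 0<xy = <-respʳ-≈ eq (*-pos (recip-pos 0<x) 0<xy)
    where
    eq : recip (pos⇒# 0<x) * (x * y) ≈ y
    eq = trans (solve 3 (λ r x y → r :* (x :* y) := (x :* r) :* y) refl (recip (pos⇒# 0<x)) x y)
      (trans (*-congʳ (recip-inverseʳ (pos⇒# 0<x))) (*-identityˡ y))

  0<2 : 0# < 1# + 1#
  0<2 = pos+nonneg 0<1 (<⇒≤ 0<1)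

  opaque
    ½ : ℝ
    ½ = recip (pos⇒# 0<2)

    0<½ : 0# < ½
    0<½ = recip-pos 0<2

    halves : ∀ x → ½ * x + ½ * x ≈ x
    halves x = trans (solve 2 (λ h x → h :* x :+ h :* x := ((1: :+ 1:) :* h) :* x) refl ½ x)
      (trans (*-congʳ (recip-inverseʳ (pos⇒# 0<2))) (*-identityˡ x))

    -- Division packaged with positivity. With `e` equal to `1#` it gives reciprocals; in limits it
    -- converts a target accuracy into the one needed before multiplying by `B`.
    ∃-quotient : ∀ {B e} → 0# < B → 0# < e → ∃[ δ ] (0# < δ × B * δ ≈ e)
    ∃-quotient {B} {e} 0<B 0<e = recip (pos⇒# 0<B) * e , *-pos (recip-pos 0<B) 0<e ,
      trans (sym (*-assoc _ _ _)) (trans (*-congʳ (recip-inverseʳ (pos⇒# 0<B))) (*-identityˡ e))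

  double-cancel-≤ : ∀ {x y} → x + x ≤ y + y → x ≤ y
  double-cancel-≤ 2x≤2y y<x = 2x≤2y (+-mono-< y<x y<x)

  monotone : (s : ℕ → ℝ) → (∀ k → s k ≤ s (suc k)) → ∀ {m n} → m ℕ.≤ n → s m ≤ s n
  monotone s step m≤n = go (ℕ.≤⇒≤′ m≤n)
    where
    go : ∀ {m n} → m ℕ.≤′ n → s m ≤ s n
    go (ℕ.≤′-reflexive ≡.refl) = ≤-reflexive refl
    go (ℕ.≤′-step m≤n)         = ≤-trans (go m≤n) (step _)

  0≤fromℕ : ∀ n → 0# ≤ fromℕ n
  0≤fromℕ n = sum-nonneg {n} _ (λ _ → <⇒≤ 0<1)

  fromℕ-mono-≤ : ∀ {m n} → m ℕ.≤ n → fromℕ m ≤ fromℕ n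
  fromℕ-mono-≤ = monotone fromℕ λ k →
    ≤-respˡ (+-identityˡ _) (+-mono-≤ (<⇒≤ 0<1) (≤-reflexive refl))

-- Finite sums and partial sums of series.

module FiniteSums {c ℓ₁ ℓ₂ ℓ₃} (𝓡 : RealNumbers c ℓ₁ ℓ₂ ℓ₃) where
  open RealNumbers 𝓡
  open OrderedFieldProperties 𝓡
  open SetoidReasoning setoid
  open RingProperties (CommutativeRing.ring commutativeRing) using (-1*x≈-x)
  open SemiringSum (CommutativeRing.semiring commutativeRing) public
    using (sum-cong-≋; ∑-distrib-+; ∑-comm; *-distribˡ-sum; *-distribʳ-sum)

  sum-cong : ∀ {n} {f g : Fin n → ℝ} → (∀ i → f i ≈ g i) → sum f ≈ sum g
  sum-cong f≈g = sum-cong-≋ f≈g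

  sum-neg : ∀ {n} (f : Fin n → ℝ) → sum (λ i → - f i) ≈ - sum f
  sum-neg f = begin
    sum (λ i → - f i)          ≈⟨ sum-cong (λ i → -1*x≈-x (f i)) ⟨
    sum (λ i → - 1# * f i)     ≈⟨ *-distribˡ-sum (- 1#) f ⟨
    - 1# * sum f               ≈⟨ -1*x≈-x (sum f) ⟩
    - sum f                    ∎

  sum-sub : ∀ {n} (f g : Fin n → ℝ) → sum (λ i → f i - g i) ≈ sum f - sum g
  sum-sub f g = trans (∑-distrib-+ f _) (+-congˡ (sum-neg g))

  sum-zero : ∀ {n} {f : Fin n → ℝ} → (∀ i → f i ≈ 0#) → sum f ≈ 0#
  sum-zero {zero}  f≈0 = refl
  sum-zero {suc n} f≈0 = trans (+-cong (f≈0 zero) (sum-zero (λ i → f≈0 (suc i)))) (+-identityˡ 0#)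

  sum-select : ∀ {n} (i : Fin n) (f : Fin n → ℝ) →
               sum (λ j → if does (j ≟ i) then f j else 0#) ≈ f i
  sum-select {suc n} zero f = trans (+-congˡ (sum-zero {n} (λ _ → refl))) (+-identityʳ _)
  sum-select (suc i) f = trans (+-identityˡ _) (sum-select i (λ j → f (suc j)))

  sum-select′ : ∀ {n} (i : Fin n) (f : Fin n → ℝ) →
                sum (λ j → if does (i ≟ j) then f j else 0#) ≈ f i
  sum-select′ {suc n} zero f = trans (+-congˡ (sum-zero {n} (λ _ → refl))) (+-identityʳ _)
  sum-select′ (suc i) f = trans (+-identityˡ _) (sum-select′ i (λ j → f (suc j)))

  sum-++ : ∀ m {n} (f : Fin (m ℕ.+ n) → ℝ) →
           sum f ≈ sum (λ i → f (i ↑ˡ n)) + sum (λ j → f (m ↑ʳ j))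
  sum-++ zero    f = sym (+-identityˡ _)
  sum-++ (suc m) f = trans (+-congˡ (sum-++ m (λ i → f (suc i)))) (sym (+-assoc _ _ _))

  sum-combine : ∀ n {d} (f : Fin (n ℕ.* d) → ℝ) →
                sum f ≈ sum (λ i → sum (λ a → f (combine {n} {d} i a)))
  sum-combine zero        f = refl
  sum-combine (suc n) {d} f = trans (sum-++ d f) (+-congˡ (sum-combine n (λ i → f (d ↑ʳ i))))

  *-sum-comm : ∀ {m n} (f : Fin m → ℝ) (g : Fin m → Fin n → ℝ) →
               sum (λ i → f i * sum (g i)) ≈ sum (λ j → sum (λ i → f i * g i j))
  *-sum-comm {m} {n} f g = trans (sum-cong (λ i → *-distribˡ-sum (f i) (g i))) (∑-comm {m} {n} _)

  if-* : ∀ (t : Bool) x y → (if t then x else 0#) * y ≈ (if t then x * y else 0#)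
  if-* true  x y = refl
  if-* false x y = zeroˡ y

  partialSum : (ℕ → ℝ) → ℕ → ℝ
  partialSum a N = sum {N} (λ k → a (toℕ k))

  partialSum-suc : ∀ a N → partialSum a (suc N) ≈ partialSum a N + a N
  partialSum-suc a zero    = +-comm (a 0) 0#
  partialSum-suc a (suc N) =
    trans (+-congˡ (partialSum-suc (λ k → a (suc k)) N))
      (sym (+-assoc (a 0) (partialSum (λ k → a (suc k)) N) (a (suc N))))


-- Limits of sequences and convergence of series.

module Limits {c ℓ₁ ℓ₂ ℓ₃} (𝓡 : RealNumbers c ℓ₁ ℓ₂ ℓ₃) where
  open RealNumbers 𝓡
  open OrderedFieldProperties 𝓡
  open FiniteSums 𝓡

  0<½* : ∀ {e} → 0# < e → 0# < ½ * e
  0<½* = *-pos 0<½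

  Within-cong : ∀ {e x y x′ y′} → x ≈ x′ → y ≈ y′ → Within e x y → Within e x′ y′
  Within-cong x≈x′ y≈y′ (p , q) =
    <-respˡ-≈ (+-cong x≈x′ (-‿cong y≈y′)) p , <-respˡ-≈ (+-cong y≈y′ (-‿cong x≈x′)) q

  Within-refl : ∀ {e} x → 0# < e → Within e x x
  Within-refl x 0<e = <-respˡ-≈ (sym (-‿inverseʳ x)) 0<e , <-respˡ-≈ (sym (-‿inverseʳ x)) 0<e

  Within-sym : ∀ {e x y} → Within e x y → Within e y x
  Within-sym (p , q) = q , p

  Within-+ : ∀ {e x y z w} → Within (½ * e) x y → Within (½ * e) z w → Within e (x + z) (y + w)
  Within-+ {e} {x} {y} {z} {w} (p , q) (r , s) =
    <-respʳ-≈ (halves e) (<-respˡ-≈ (rearrange x y z w) (+-mono-< p r)) ,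
    <-respʳ-≈ (halves e) (<-respˡ-≈ (rearrange y x w z) (+-mono-< q s))
    where
    rearrange : ∀ x y z w → (x - y) + (z - w) ≈ (x + z) - (y + w)
    rearrange = solve 4 (λ x y z w → (x :- y) :+ (z :- w) := (x :+ z) :- (y :+ w)) refl

  Within-trans : ∀ {e x y z} → Within (½ * e) x y → Within (½ * e) y z → Within e x z
  Within-trans {e} {x} {y} {z} p q = Within-cancel (Within-+ p q)
    where
    Within-cancel : Within e (x + y) (y + z) → Within e x z
    Within-cancel (r , s) =
      <-respˡ-≈ (solve 3 (λ x y z → (x :+ y) :- (y :+ z) := x :- z) refl x y z) r ,
      <-respˡ-≈ (solve 3 (λ x y z → (y :+ z) :- (x :+ y) := z :- x) refl x y z) s

  ConvergesTo-cong : ∀ {s t : ℕ → ℝ} {l m} → (∀ k → s k ≈ t k) → l ≈ m →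
                     ConvergesTo s l → ConvergesTo t m
  ConvergesTo-cong s≈t l≈m s→l e 0<e with s→l e 0<e
  ... | N , close = N , λ k N≤k → Within-cong (s≈t k) l≈m (close k N≤k)

  ConvergesTo-const : ∀ x → ConvergesTo (λ _ → x) x
  ConvergesTo-const x e 0<e = 0 , λ _ _ → Within-refl x 0<e

  ConvergesTo-suc : ∀ {s : ℕ → ℝ} {l} → ConvergesTo s l → ConvergesTo (λ k → s (suc k)) l
  ConvergesTo-suc s→l e 0<e with s→l e 0<e
  ... | N , close = N , λ k N≤k → close (suc k) (ℕ.m≤n⇒m≤1+n N≤k)

  ConvergesTo-+ : ∀ {s t : ℕ → ℝ} {l m} → ConvergesTo s l → ConvergesTo t m →
                  ConvergesTo (λ k → s k + t k) (l + m)
  ConvergesTo-+ s→l t→m e 0<e with s→l (½ * e) (0<½* 0<e) | t→m (½ * e) (0<½* 0<e)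
  ... | M , p | N , q = M ℕ.⊔ N , λ k M⊔N≤k →
    Within-+ (p k (ℕ.m⊔n≤o⇒m≤o M N M⊔N≤k)) (q k (ℕ.m⊔n≤o⇒n≤o M N M⊔N≤k))

  ConvergesTo-sum : ∀ {n} {s : Fin n → ℕ → ℝ} {l : Fin n → ℝ} → (∀ i → ConvergesTo (s i) (l i)) →
                    ConvergesTo (λ k → sum (λ i → s i k)) (sum l)
  ConvergesTo-sum {zero}  s→l = ConvergesTo-const 0#
  ConvergesTo-sum {suc n} {s} {l} s→l =
    ConvergesTo-+ {s zero} {λ k → sum (λ i → s (suc i) k)} {l zero} {sum (λ i → l (suc i))}
      (s→l zero) (ConvergesTo-sum {n} {λ i → s (suc i)} {λ i → l (suc i)} (λ i → s→l (suc i)))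

  -- With |x| < B and |z| < δ, the sum of (B - x) (δ + z) and (B + x) (δ - z) is
  -- 2 (B δ - x z).
  *-bound : ∀ {B δ x z} → x < B → - x < B → z < δ → - z < δ → x * z < B * δ
  *-bound {B} {δ} {x} {z} x<B -x<B z<δ -z<δ = 0<-⇒< (*-cancelˡ-pos 0<2 (<-respʳ-≈
    (solve 4 (λ B δ x z → (B :- x) :* (δ :- :- z) :+ (B :- :- x) :* (δ :- z) :=
                          (1: :+ 1:) :* (B :* δ :- x :* z)) refl B δ x z)
    (pos+nonneg (*-pos (<⇒0<- x<B) (<⇒0<- -z<δ)) (<⇒≤ (*-pos (<⇒0<- -x<B) (<⇒0<- z<δ))))))

  opaque
    -- One number has to dominate both `x` and `- x`. Adding their Archimedean bounds avoids
    -- comparing the two, and the extra `1#` makes the result positive.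
    ∃-strict-bound : ∀ x → ∃[ B ] (0# < B × x < B × - x < B)
    ∃-strict-bound x with m , x<m ← archimedean x | m′ , -x<m′ ← archimedean (- x) =
      1# + (fromℕ m + fromℕ m′) ,
      pos+nonneg 0<1 (nonneg+nonneg (0≤fromℕ m) (0≤fromℕ m′)) ,
      <-trans x<m (0<-⇒< (<-respʳ-≈
        (solve 2 (λ a b → 1: :+ b := (1: :+ (a :+ b)) :- a) refl (fromℕ m) (fromℕ m′))
        (pos+nonneg 0<1 (0≤fromℕ m′)))) ,
      <-trans -x<m′ (0<-⇒< (<-respʳ-≈
        (solve 2 (λ a b → 1: :+ a := (1: :+ (a :+ b)) :- b) refl (fromℕ m) (fromℕ m′))
        (pos+nonneg 0<1 (0≤fromℕ m))))

  Within-*ˡ : ∀ {B δ y z} x → x < B → - x < B → Within δ y z → Within (B * δ) (x * y) (x * z)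
  Within-*ˡ {B} {δ} {y} {z} x x<B -x<B (p , q) =
    <-respˡ-≈ (difference x y z) (*-bound x<B -x<B p (<-respˡ-≈ (negate z y) q)) ,
    <-respˡ-≈ (difference x z y) (*-bound x<B -x<B q (<-respˡ-≈ (negate y z) p))
    where
    difference : ∀ x y z → x * (y - z) ≈ x * y - x * z
    difference = solve 3 (λ x y z → x :* (y :- z) := x :* y :- x :* z) refl
    negate : ∀ y z → y - z ≈ - (z - y)
    negate = solve 2 (λ y z → y :- z := :- (z :- y)) refl

  ConvergesTo-*ˡ : ∀ {s : ℕ → ℝ} {l} x → ConvergesTo s l → ConvergesTo (λ k → x * s k) (x * l)
  ConvergesTo-*ˡ {s} {l} x s→l e 0<e with ∃-strict-bound x
  ... | B , 0<B , x<B , -x<B with ∃-quotient 0<B 0<e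
  ... | δ , 0<δ , Bδ≈e with s→l δ 0<δ
  ... | N , close = N , λ k N≤k →
    let (p , q) = Within-*ˡ x x<B -x<B (close k N≤k)
    in <-respʳ-≈ Bδ≈e p , <-respʳ-≈ Bδ≈e q

  limit-≮ : ∀ {s : ℕ → ℝ} {l m} → ConvergesTo s l → ConvergesTo s m → ¬ (l < m)
  limit-≮ {l = l} {m} s→l s→m l<m
    -- With tolerance half the gap, `l` and `m` would lie strictly within `m - l` of each other,
    -- that is, `m - l < m - l`.
    with s→l (½ * (m - l)) (0<½* (<⇒0<- l<m)) | s→m (½ * (m - l)) (0<½* (<⇒0<- l<m))
  ... | M , p | N , q = <-irrefl refl (proj₂ (Within-trans
    (Within-sym (p (M ℕ.⊔ N) (ℕ.m≤m⊔n M N))) (q (M ℕ.⊔ N) (ℕ.m≤n⊔m M N))))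

  limit-unique : ∀ {s : ℕ → ℝ} {l m} → ConvergesTo s l → ConvergesTo s m → l ≈ m
  limit-unique s→l s→m = ≤-antisym (limit-≮ s→m s→l) (limit-≮ s→l s→m)

  -- The two hypotheses express |a| ≤ b. They make the partial sums of both `b - a` and `b + a`
  -- increasing, so each increment of the partial sums of `a` is bounded in both directions by that
  -- of `b`, and the Cauchy property carries over.
  comparison-test : ∀ {a b : ℕ → ℝ} {l} → (∀ k → a k ≤ b k) → (∀ k → - a k ≤ b k) →
                    SumsTo b l → ∃[ m ] SumsTo a m
  comparison-test {a} {b} {l} a≤b -a≤b Σb→l = complete (partialSum a) cauchy
    where
    upper : ∀ {k m} → k ℕ.≤ m → partialSum a m - partialSum a k ≤ partialSum b m - partialSum b k
    upper {k} {m} k≤m = 0≤-⇒≤ (≤-respʳ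
      (solve 4 (λ am ak bm bk → (bm :- am) :- (bk :- ak) := (bm :- bk) :- (am :- ak)) refl
        (partialSum a m) (partialSum a k) (partialSum b m) (partialSum b k))
      (≤⇒0≤- (monotone (λ k → partialSum b k - partialSum a k) step k≤m)))
      where
      step : ∀ k → partialSum b k - partialSum a k ≤ partialSum b (suc k) - partialSum a (suc k)
      step k = 0≤-⇒≤ (≤-respʳ (trans
        (solve 4 (λ x y A B → y :- x := ((B :+ y) :- (A :+ x)) :- (B :- A)) refl
          (a k) (b k) (partialSum a k) (partialSum b k))
        (+-congʳ (sym (+-cong (partialSum-suc b k) (-‿cong (partialSum-suc a k))))))
        (≤⇒0≤- (a≤b k)))

    lower : ∀ {k m} → k ℕ.≤ m → partialSum a k - partialSum a m ≤ partialSum b m - partialSum b k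
    lower {k} {m} k≤m = 0≤-⇒≤ (≤-respʳ
      (solve 4 (λ am ak bm bk → (bm :+ am) :- (bk :+ ak) := (bm :- bk) :- (ak :- am)) refl
        (partialSum a m) (partialSum a k) (partialSum b m) (partialSum b k))
      (≤⇒0≤- (monotone (λ k → partialSum b k + partialSum a k) step k≤m)))
      where
      step : ∀ k → partialSum b k + partialSum a k ≤ partialSum b (suc k) + partialSum a (suc k)
      step k = 0≤-⇒≤ (≤-respʳ (trans
        (solve 4 (λ x y A B → y :- :- x := ((B :+ y) :+ (A :+ x)) :- (B :+ A)) refl
          (a k) (b k) (partialSum a k) (partialSum b k))
        (+-congʳ (sym (+-cong (partialSum-suc b k) (partialSum-suc a k)))))
        (≤⇒0≤- (-a≤b k)))

    cauchy : Cauchy (partialSum a)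
    cauchy e 0<e with Σb→l (½ * e) (0<½* 0<e)
    ... | N , close = N , go
      where
      ordered : ∀ {k m} → N ℕ.≤ k → N ℕ.≤ m → k ℕ.≤ m → Within e (partialSum a m) (partialSum a k)
      ordered N≤k N≤m k≤m = ≤-<-trans (upper k≤m) b-close , ≤-<-trans (lower k≤m) b-close
        where
        b-close = proj₁ (Within-trans (close _ N≤m) (Within-sym (close _ N≤k)))
      go : ∀ m k → N ℕ.≤ m → N ℕ.≤ k → Within e (partialSum a m) (partialSum a k)
      go m k N≤m N≤k with ℕ.≤-total k m
      ... | inj₁ k≤m = ordered N≤k N≤m k≤m
      ... | inj₂ m≤k = Within-sym (ordered N≤m N≤k m≤k)

-- Solvability of linear systems with a positive form.

module PositiveForms {c ℓ₁ ℓ₂ ℓ₃} (𝓡 : RealNumbers c ℓ₁ ℓ₂ ℓ₃) where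
  open RealNumbers 𝓡
  open OrderedFieldProperties 𝓡
  open FiniteSums 𝓡
  open Matrices 𝓡
  open SetoidReasoning setoid

  PositiveForm : ∀ {m} → Matrix m m → Set (c ⊔ ℓ₂ ⊔ ℓ₃)
  PositiveForm A = ∀ x → NonZeroVector x → 0# < quadraticForm A x

  module _ {m} (A : Matrix (suc m) (suc m)) where
    α : ℝ
    α = A zero zero

    row column : Fin m → ℝ
    row    b = A zero (suc b)
    column a = A (suc a) zero

    block : Matrix m m
    block a b = A (suc a) (suc b)

    quadraticForm-∷ : ∀ x₀ y → quadraticForm A (x₀ ∷ᵛ y) ≈
      x₀ * α * x₀ + x₀ * sum (λ b → row b * y b) + sum (λ a → y a * column a) * x₀ + quadraticForm block y
    quadraticForm-∷ x₀ y = begin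
      (x₀ * α * x₀ + sum (λ b → x₀ * row b * y b)) +
        sum (λ a → y a * column a * x₀ + sum (λ b → y a * block a b * y b))
        ≈⟨ +-cong
             (+-congˡ (trans (sum-cong (λ b → *-assoc x₀ (row b) (y b)))
                             (sym (*-distribˡ-sum x₀ (λ b → row b * y b)))))
             (trans (∑-distrib-+ (λ a → y a * column a * x₀) (λ a → sum (λ b → y a * block a b * y b)))
                    (+-congʳ (sym (*-distribʳ-sum x₀ (λ a → y a * column a))))) ⟩
      (x₀ * α * x₀ + x₀ * sum (λ b → row b * y b)) +
        (sum (λ a → y a * column a) * x₀ + quadraticForm block y)
        ≈⟨ +-assoc _ _ _ ⟨
      x₀ * α * x₀ + x₀ * sum (λ b → row b * y b) + sum (λ a → y a * column a) * x₀ + quadraticForm block y ∎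

    corner-pos : PositiveForm A → 0# < α
    corner-pos A>0 = <-respʳ-≈ eq (A>0 (1# ∷ᵛ (λ _ → 0#)) (zero , 1#0))
      where
      eq : quadraticForm A (1# ∷ᵛ (λ _ → 0#)) ≈ α
      eq = begin
        quadraticForm A (1# ∷ᵛ (λ _ → 0#))
          ≈⟨ quadraticForm-∷ 1# (λ _ → 0#) ⟩
        1# * α * 1# + 1# * sum (λ b → row b * 0#) + sum (λ a → 0# * column a) * 1# + quadraticForm block (λ _ → 0#)
          ≈⟨ +-cong (+-cong (+-congˡ (*-congˡ (sum-zero (λ b → zeroʳ (row b)))))
                            (*-congʳ (sum-zero (λ a → zeroˡ (column a)))))
                    (sum-zero (λ a → sum-zero (λ b → zeroʳ (0# * block a b)))) ⟩
        1# * α * 1# + 1# * 0# + 0# * 1# + 0#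
          ≈⟨ solve 1 (λ α → 1: :* α :* 1: :+ 1: :* 0: :+ 0: :* 1: :+ 0: := α) refl α ⟩
        α ∎

    -- With `ρ` the inverse of the corner `α`, this is the system that remains after the first
    -- unknown has been eliminated.
    schurComplement : ℝ → Matrix m m
    schurComplement ρ a b = block a b - column a * ρ * row b

    module _ (ρ : ℝ) (αρ≈1 : α * ρ ≈ 1#) where

      quadraticForm-schur : ∀ y → quadraticForm (schurComplement ρ) y ≈
        quadraticForm block y - sum (λ a → y a * column a) * (ρ * sum (λ b → row b * y b))
      quadraticForm-schur y = begin
        sum (λ a → sum (λ b → y a * (block a b - column a * ρ * row b) * y b))
          ≈⟨ sum-cong (λ a → sum-cong (λ b →
               solve 6 (λ ya C s ρ r yb → ya :* (C :- s :* ρ :* r) :* yb :=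
                                          ya :* C :* yb :- (ya :* s) :* (ρ :* (r :* yb))) refl
                 (y a) (block a b) (column a) ρ (row b) (y b))) ⟩
        sum (λ a → sum (λ b → y a * block a b * y b - (y a * column a) * (ρ * (row b * y b))))
          ≈⟨ sum-cong (λ a → trans
               (sum-sub (λ b → y a * block a b * y b) (λ b → (y a * column a) * (ρ * (row b * y b))))
               (+-congˡ (-‿cong (trans
                 (sym (*-distribˡ-sum (y a * column a) (λ b → ρ * (row b * y b))))
                 (*-congˡ (sym (*-distribˡ-sum ρ (λ b → row b * y b)))))))) ⟩
        sum (λ a → sum (λ b → y a * block a b * y b) - (y a * column a) * (ρ * sum (λ b → row b * y b)))
          ≈⟨ trans (sum-sub (λ a → sum (λ b → y a * block a b * y b))
                            (λ a → (y a * column a) * (ρ * sum (λ b → row b * y b))))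
                   (+-congˡ (-‿cong (sym (*-distribʳ-sum _ (λ a → y a * column a))))) ⟩
        quadraticForm block y - sum (λ a → y a * column a) * (ρ * sum (λ b → row b * y b)) ∎

      -- The first coordinate `- (ρ * R)` is the one for which the first row of `A` annihilates the
      -- vector. On such vectors the form of `A` restricts to the form of the Schur complement.
      schur-positive : PositiveForm A → PositiveForm (schurComplement ρ)
      schur-positive A>0 y (a , y#0) =
        <-respʳ-≈ eq (A>0 (- (ρ * R) ∷ᵛ y) (suc a , y#0))
        where
        R = sum (λ b → row b * y b)
        S = sum (λ a → y a * column a)
        Q = quadraticForm block y
        eq : quadraticForm A (- (ρ * R) ∷ᵛ y) ≈ quadraticForm (schurComplement ρ) y
        eq = begin
          quadraticForm A (- (ρ * R) ∷ᵛ y)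
            ≈⟨ quadraticForm-∷ (- (ρ * R)) y ⟩
          - (ρ * R) * α * - (ρ * R) + - (ρ * R) * R + S * - (ρ * R) + Q
            -- The solver knows nothing of `αρ≈1`, so the identity is arranged to collect everything
            -- that depends on it behind the factor `α * ρ - 1#`.
            ≈⟨ solve 5 (λ α ρ R S Q →
                 (:- (ρ :* R)) :* α :* (:- (ρ :* R)) :+ (:- (ρ :* R)) :* R :+ S :* (:- (ρ :* R)) :+ Q :=
                 (α :* ρ :- 1:) :* (ρ :* (R :* R)) :+ (Q :- S :* (ρ :* R))) refl α ρ R S Q ⟩
          (α * ρ - 1#) * (ρ * (R * R)) + (Q - S * (ρ * R))
            ≈⟨ +-congʳ (trans (*-congʳ (trans (+-congʳ αρ≈1) (-‿inverseʳ 1#))) (zeroˡ _)) ⟩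
          0# + (Q - S * (ρ * R))
            ≈⟨ +-identityˡ _ ⟩
          Q - S * (ρ * R)
            ≈⟨ quadraticForm-schur y ⟨
          quadraticForm (schurComplement ρ) y ∎

      -- Back substitution: `x₀` is read off from the first row, and the multiple of that row which
      -- the elimination subtracted is restored in the others.
      lift-solution : ∀ (b : Fin (suc m) → ℝ) (y : Fin m → ℝ) →
        (∀ a → sum (λ j → schurComplement ρ a j * y j) ≈ b (suc a) - column a * (ρ * b zero)) →
        Σ[ x ∈ (Fin (suc m) → ℝ) ] (∀ i → sum (λ j → A i j * x j) ≈ b i)
      lift-solution b y solves = x₀ ∷ᵛ y , rows
        where
        R  = sum (λ j → row j * y j)
        x₀ = ρ * (b zero - R)
        rows : ∀ i → sum (λ j → A i j * (x₀ ∷ᵛ y) j) ≈ b i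
        rows zero = begin
          α * (ρ * (b zero - R)) + R
            ≈⟨ solve 4 (λ α ρ b R → α :* (ρ :* (b :- R)) :+ R := (α :* ρ :- 1:) :* (b :- R) :+ b)
                 refl α ρ (b zero) R ⟩
          (α * ρ - 1#) * (b zero - R) + b zero
            ≈⟨ +-congʳ (trans (*-congʳ (trans (+-congʳ αρ≈1) (-‿inverseʳ 1#))) (zeroˡ _)) ⟩
          0# + b zero
            ≈⟨ +-identityˡ _ ⟩
          b zero ∎
        rows (suc a) = begin
          column a * x₀ + sum (λ j → block a j * y j)
            ≈⟨ +-congˡ split ⟩
          column a * x₀ + ((b (suc a) - column a * (ρ * b zero)) + column a * ρ * R)
            ≈⟨ solve 5 (λ s ρ b₀ R b → s :* (ρ :* (b₀ :- R)) :+ ((b :- s :* (ρ :* b₀)) :+ s :* ρ :* R) := b)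
                 refl (column a) ρ (b zero) R (b (suc a)) ⟩
          b (suc a) ∎
          where
          split : sum (λ j → block a j * y j) ≈ (b (suc a) - column a * (ρ * b zero)) + column a * ρ * R
          split = begin
            sum (λ j → block a j * y j)
              ≈⟨ sum-cong (λ j →
                   solve 5 (λ C s ρ r y → C :* y := (C :- s :* ρ :* r) :* y :+ s :* ρ :* (r :* y))
                     refl (block a j) (column a) ρ (row j) (y j)) ⟩
            sum (λ j → schurComplement ρ a j * y j + column a * ρ * (row j * y j))
              ≈⟨ ∑-distrib-+ (λ j → schurComplement ρ a j * y j) (λ j → column a * ρ * (row j * y j)) ⟩
            sum (λ j → schurComplement ρ a j * y j) + sum (λ j → column a * ρ * (row j * y j))
              ≈⟨ +-cong (solves a) (sym (*-distribˡ-sum (column a * ρ) (λ j → row j * y j))) ⟩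
            (b (suc a) - column a * (ρ * b zero)) + column a * ρ * R ∎

  -- Gaussian elimination without a search for pivots: positivity makes the corner a valid pivot and
  -- is inherited by the Schur complement.
  positive⇒solvable : ∀ {m} (A : Matrix m m) → PositiveForm A →
    (b : Fin m → ℝ) → Σ[ x ∈ (Fin m → ℝ) ] (∀ i → sum (λ j → A i j * x j) ≈ b i)
  positive⇒solvable {zero}  A A>0 b = (λ ()) , λ ()
  positive⇒solvable {suc m} A A>0 b with ∃-quotient (corner-pos A A>0) 0<1
  ... | ρ , _ , αρ≈1 with positive⇒solvable (schurComplement A ρ) (schur-positive A ρ αρ≈1 A>0)
                            (λ a → b (suc a) - column A a * (ρ * b zero))
  ... | y , solves = lift-solution A ρ αρ≈1 b y solves

-- Identity matrices, inverses and dot products.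

module MatrixProperties {c ℓ₁ ℓ₂ ℓ₃} (𝓡 : RealNumbers c ℓ₁ ℓ₂ ℓ₃) where
  open RealNumbers 𝓡
  open OrderedFieldProperties 𝓡
  open FiniteSums 𝓡
  open Matrices 𝓡
  open SetoidReasoning setoid

  I-symmetric : ∀ {m} (a b : Fin m) → I a b ≈ I b a
  I-symmetric a b with a ≟ b | b ≟ a
  ... | yes _      | yes _  = refl
  ... | no  _      | no  _  = refl
  ... | yes ≡.refl | no b≢a = ⊥-elim (b≢a ≡.refl)
  ... | no a≢b     | yes ≡.refl = ⊥-elim (a≢b ≡.refl)

  I-act : ∀ {m} (v : Fin m → ℝ) a → sum (λ b → I a b * v b) ≈ v a
  I-act v a = begin
    sum (λ b → I a b * v b)
      ≈⟨ sum-cong (λ b → trans (if-* (does (a ≟ b)) 1# (v b)) (unit b)) ⟩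
    sum (λ b → if does (a ≟ b) then v b else 0#)
      ≈⟨ sum-select′ a v ⟩
    v a ∎
    where
    unit : ∀ b → (if does (a ≟ b) then 1# * v b else 0#) ≈ (if does (a ≟ b) then v b else 0#)
    unit b with does (a ≟ b)
    ... | true  = *-identityˡ (v b)
    ... | false = refl

  I-act′ : ∀ {m} (v : Fin m → ℝ) a → sum (λ b → v b * I b a) ≈ v a
  I-act′ v a = trans (sum-cong (λ b → trans (*-comm (v b) (I b a)) (*-congʳ (I-symmetric b a)))) (I-act v a)

  *-sum-assoc : ∀ {m n} (f : Fin m → ℝ) (A : Matrix m n) (g : Fin n → ℝ) →
    sum (λ i → f i * sum (λ j → A i j * g j)) ≈ sum (λ j → sum (λ i → f i * A i j) * g j)
  *-sum-assoc f A g = begin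
    sum (λ i → f i * sum (λ j → A i j * g j))
      ≈⟨ *-sum-comm f (λ i j → A i j * g j) ⟩
    sum (λ j → sum (λ i → f i * (A i j * g j)))
      ≈⟨ sum-cong (λ j → sum-cong (λ i → *-assoc (f i) (A i j) (g j))) ⟨
    sum (λ j → sum (λ i → f i * A i j * g j))
      ≈⟨ sum-cong (λ j → *-distribʳ-sum (g j) (λ i → f i * A i j)) ⟨
    sum (λ j → sum (λ i → f i * A i j) * g j) ∎

  -- For symmetric `A`, M = (A M)ᵀ M = Mᵀ (A M) = Mᵀ, so `M` is symmetric as well, and transposing A
  -- M = I gives M A = I.
  symmetric-rightInverse⇒Invertible : ∀ {m} (A M : Matrix m m) → Symmetric A → A · M ≋ I → Invertible A
  symmetric-rightInverse⇒Invertible A M A-sym AM≈I = M , MA≈I , AM≈I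
    where
    M-sym : ∀ r s → M r s ≈ M s r
    M-sym r s = begin
      M r s
        ≈⟨ I-act (λ u → M u s) r ⟨
      sum (λ u → I r u * M u s)
        ≈⟨ sum-cong (λ u → *-congʳ (trans (I-symmetric r u) (sym (AM≈I u r)))) ⟩
      sum (λ u → sum (λ t → A u t * M t r) * M u s)
        ≈⟨ sum-cong (λ u → *-congʳ {M u s} (sum-cong (λ t → trans (*-congʳ (A-sym t u)) (*-comm (A t u) (M t r))))) ⟩
      sum (λ u → sum (λ t → M t r * A t u) * M u s)
        ≈⟨ *-sum-assoc (λ t → M t r) A (λ u → M u s) ⟨
      sum (λ t → M t r * sum (λ u → A t u * M u s))
        ≈⟨ sum-cong (λ t → *-congˡ (AM≈I t s)) ⟩
      sum (λ t → M t r * I t s)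
        ≈⟨ I-act′ (λ t → M t r) s ⟩
      M s r ∎
    MA≈I : M · A ≋ I
    MA≈I r s = begin
      sum (λ t → M r t * A t s)
        ≈⟨ sum-cong (λ t → trans (*-cong (M-sym r t) (A-sym s t)) (*-comm (M t r) (A s t))) ⟩
      sum (λ t → A s t * M t r)
        ≈⟨ AM≈I s r ⟩
      I s r
        ≈⟨ I-symmetric s r ⟩
      I r s ∎

  dot : ∀ {m} → (Fin m → ℝ) → (Fin m → ℝ) → ℝ
  dot u v = sum (λ a → u a * v a)

  dot-comm : ∀ {m} (u v : Fin m → ℝ) → dot u v ≈ dot v u
  dot-comm u v = sum-cong (λ a → *-comm (u a) (v a))

  dot-subʳ : ∀ {m} (u v z : Fin m → ℝ) → dot u (λ a → v a - z a) ≈ dot u v - dot u z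
  dot-subʳ u v z = trans
    (sum-cong (λ a → solve 3 (λ u v z → u :* (v :- z) := u :* v :- u :* z) refl (u a) (v a) (z a)))
    (sum-sub (λ a → u a * v a) (λ a → u a * z a))

  dot-subˡ : ∀ {m} (u v z : Fin m → ℝ) → dot (λ a → u a - v a) z ≈ dot u z - dot v z
  dot-subˡ u v z = trans
    (sum-cong (λ a → solve 3 (λ u v z → (u :- v) :* z := u :* z :- v :* z) refl (u a) (v a) (z a)))
    (sum-sub (λ a → u a * z a) (λ a → v a * z a))


-- The connection Laplacian and its energy form.

module ConnectionProperties {c ℓ₁ ℓ₂ ℓ₃} (𝓡 : RealNumbers c ℓ₁ ℓ₂ ℓ₃)
  {n d : ℕ} (Γ : Graphs.ConnectionGraph 𝓡 n d) where
  open RealNumbers 𝓡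
  open OrderedFieldProperties 𝓡
  open FiniteSums 𝓡
  open Matrices 𝓡
  open MatrixProperties 𝓡
  open Graphs.ConnectionGraph Γ
  open Connection 𝓡 Γ
  open SetoidReasoning setoid

  ~-sym : ∀ {x y} → x ~ y → y ~ x
  ~-sym {x} {y} x~y = Equivalence.to (w-positive y x)
    (<-respʳ-≈ (w-symmetric x y) (Equivalence.from (w-positive x y) x~y))

  w-nonedge : ∀ {x y} → ¬ (x ~ y) → w x y ≈ 0#
  w-nonedge {x} {y} x≁y = ≤-antisym (λ 0<w → x≁y (Equivalence.to (w-positive x y) 0<w)) (w-nonneg x y)

  -- Identities such as the isometry of transport hold along edges only; the weight makes them
  -- usable in sums over all pairs of vertices.
  w-*-cong : ∀ x y {s t : ℝ} → (x ~ y → s ≈ t) → w x y * s ≈ w x y * t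
  w-*-cong x y {s} {t} s≈t with x ~? y
  ... | yes x~y = *-congˡ (s≈t x~y)
  ... | no  x≁y = trans (vanish s) (sym (vanish t))
    where
    vanish : ∀ s → w x y * s ≈ 0#
    vanish s = trans (*-congʳ (w-nonedge x≁y)) (zeroˡ s)

  σ₀-transpose : ∀ x y a b → σ₀ x y a b ≈ σ₀ y x b a
  σ₀-transpose x y a b with x ~? y | y ~? x
  ... | yes e   | yes e′  = σ-transpose e′ e a b
  ... | yes x~y | no y≁x  = ⊥-elim (y≁x (~-sym x~y))
  ... | no x≁y  | yes y~x = ⊥-elim (x≁y (~-sym y~x))
  ... | no _    | no _    = refl

  σ₀-orthogonal : ∀ {x y} → x ~ y → Orthogonal (σ₀ x y)
  σ₀-orthogonal {x} {y} x~y with x ~? y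
  ... | yes e  = σ-orthogonal e
  ... | no x≁y = ⊥-elim (x≁y x~y)

  -- Parallel transport from the fibre over `y` to the fibre over `x`, and zero when there is no
  -- edge.
  transport : Fin n → Fin n → (Fin d → ℝ) → Fin d → ℝ
  transport x y v a = sum (λ b → σ₀ x y a b * v b)

  transport-adjoint : ∀ x y u v → dot u (transport x y v) ≈ dot (transport y x u) v
  transport-adjoint x y u v = trans (*-sum-assoc u (σ₀ x y) v)
    (sum-cong {d} (λ b → *-congʳ (sum-cong {d} (λ a →
      trans (*-comm (u a) (σ₀ x y a b)) (*-congʳ (σ₀-transpose x y a b))))))

  transport-inverse : ∀ {x y} → x ~ y → ∀ v a → transport y x (transport x y v) a ≈ v a
  transport-inverse {x} {y} x~y v a = begin
    sum (λ b → σ₀ y x a b * sum (λ e → σ₀ x y b e * v e))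
      ≈⟨ *-sum-assoc (σ₀ y x a) (σ₀ x y) v ⟩
    sum (λ e → sum (λ b → σ₀ y x a b * σ₀ x y b e) * v e)
      ≈⟨ sum-cong {d} (λ e → *-congʳ (trans
           (sum-cong {d} (λ b → *-congʳ (σ₀-transpose y x a b)))
           (proj₂ (σ₀-orthogonal x~y) a e))) ⟩
    sum (λ e → I a e * v e)
      ≈⟨ I-act v a ⟩
    v a ∎

  transport-isometry : ∀ {x y} → x ~ y → ∀ v → dot (transport x y v) (transport x y v) ≈ dot v v
  transport-isometry {x} {y} x~y v = trans (transport-adjoint x y (transport x y v) v)
    (sum-cong {d} (λ a → *-congʳ (transport-inverse x~y v a)))

  Section : Set c
  Section = Fin n → Fin d → ℝ

  -- The connection Laplacian with vertex and coordinate kept apart; `connectionLaplacian-act` is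
  -- the passage to flattened indices.
  laplacian : Section → Section
  laplacian Φ x a = sum (λ y → sum (λ b → laplacianBlock x y a b * Φ y b))

  laplacian-cong : ∀ {Φ Ψ : Section} → (∀ x a → Φ x a ≈ Ψ x a) → ∀ x a → laplacian Φ x a ≈ laplacian Ψ x a
  laplacian-cong Φ≈Ψ x a = sum-cong {n} (λ y → sum-cong {d} (λ b → *-congˡ (Φ≈Ψ y b)))

  -- A discrete covariant derivative along the edge, measured in the fibre over `x`.
  discrepancy : Section → Fin n → Fin n → Fin d → ℝ
  discrepancy Φ x y a = Φ x a - transport x y (Φ y) a

  -- The transport term appears on the diagonal too, where the absence of loops makes its weight
  -- zero. In this uniform shape the sum over `y` splits into a degree part and an adjacency part.
  laplacianBlock-act : ∀ (Φ : Section) x y a → sum (λ b → laplacianBlock x y a b * Φ y b) ≈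
    (if does (x ≟ y) then deg x * Φ y a else 0#) - w x y * transport x y (Φ y) a
  laplacianBlock-act Φ x y a with x ≟ y
  ... | yes ≡.refl = begin
    sum (λ b → deg x * I a b * Φ x b)
      ≈⟨ sum-cong {d} (λ b → *-assoc (deg x) (I a b) (Φ x b)) ⟩
    sum (λ b → deg x * (I a b * Φ x b))
      ≈⟨ *-distribˡ-sum (deg x) (λ b → I a b * Φ x b) ⟨
    deg x * sum (λ b → I a b * Φ x b)
      ≈⟨ *-congˡ (I-act (Φ x) a) ⟩
    deg x * Φ x a
      ≈⟨ solve 2 (λ p t → p := p :- 0: :* t) refl (deg x * Φ x a) (transport x x (Φ x) a) ⟩
    deg x * Φ x a - 0# * transport x x (Φ x) a
      ≈⟨ +-congˡ (-‿cong (*-congʳ (w-nonedge (loopless x)))) ⟨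
    deg x * Φ x a - w x x * transport x x (Φ x) a ∎
  ... | no _ = begin
    sum (λ b → - w x y * σ₀ x y a b * Φ y b)
      ≈⟨ sum-cong {d} (λ b → *-assoc (- w x y) (σ₀ x y a b) (Φ y b)) ⟩
    sum (λ b → - w x y * (σ₀ x y a b * Φ y b))
      ≈⟨ *-distribˡ-sum (- w x y) (λ b → σ₀ x y a b * Φ y b) ⟨
    - w x y * transport x y (Φ y) a
      ≈⟨ solve 2 (λ w t → :- w :* t := 0: :- w :* t) refl (w x y) (transport x y (Φ y) a) ⟩
    0# - w x y * transport x y (Φ y) a ∎

  laplacian-deg : ∀ (Φ : Section) x a → laplacian Φ x a ≈ deg x * Φ x a - sum (λ y → w x y * transport x y (Φ y) a)
  laplacian-deg Φ x a = begin
    sum (λ y → sum (λ b → laplacianBlock x y a b * Φ y b))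
      ≈⟨ sum-cong {n} (λ y → laplacianBlock-act Φ x y a) ⟩
    sum (λ y → (if does (x ≟ y) then deg x * Φ y a else 0#) - w x y * transport x y (Φ y) a)
      ≈⟨ sum-sub (λ y → if does (x ≟ y) then deg x * Φ y a else 0#) (λ y → w x y * transport x y (Φ y) a) ⟩
    sum (λ y → if does (x ≟ y) then deg x * Φ y a else 0#) - sum (λ y → w x y * transport x y (Φ y) a)
      ≈⟨ +-congʳ (sum-select′ x (λ y → deg x * Φ y a)) ⟩
    deg x * Φ x a - sum (λ y → w x y * transport x y (Φ y) a) ∎

  laplacian-discrepancy : ∀ (Φ : Section) x a → laplacian Φ x a ≈ sum (λ y → w x y * discrepancy Φ x y a)
  laplacian-discrepancy Φ x a = begin
    laplacian Φ x a
      ≈⟨ laplacian-deg Φ x a ⟩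
    deg x * Φ x a - sum (λ y → w x y * transport x y (Φ y) a)
      ≈⟨ +-congʳ (*-distribʳ-sum (Φ x a) (w x)) ⟩
    sum (λ y → w x y * Φ x a) - sum (λ y → w x y * transport x y (Φ y) a)
      ≈⟨ sum-sub (λ y → w x y * Φ x a) (λ y → w x y * transport x y (Φ y) a) ⟨
    sum (λ y → w x y * Φ x a - w x y * transport x y (Φ y) a)
      ≈⟨ sum-cong {n} (λ y → solve 3 (λ w f t → w :* f :- w :* t := w :* (f :- t)) refl
           (w x y) (Φ x a) (transport x y (Φ y) a)) ⟩
    sum (λ y → w x y * discrepancy Φ x y a) ∎

  ⟪_,_⟫ : Section → Section → ℝ
  ⟪ Φ , Ψ ⟫ = sum (λ x → dot (Φ x) (Ψ x))

  ⟪,⟫-laplacian : ∀ (Φ Ψ : Section) → ⟪ Φ , laplacian Ψ ⟫ ≈ sum (λ x → sum (λ y → w x y * dot (Φ x) (discrepancy Ψ x y)))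
  ⟪,⟫-laplacian Φ Ψ = sum-cong {n} λ x → begin
    sum (λ a → Φ x a * laplacian Ψ x a)
      ≈⟨ sum-cong {d} (λ a → *-congˡ (laplacian-discrepancy Ψ x a)) ⟩
    sum (λ a → Φ x a * sum (λ y → w x y * discrepancy Ψ x y a))
      ≈⟨ *-sum-comm (Φ x) (λ a y → w x y * discrepancy Ψ x y a) ⟩
    sum (λ y → sum (λ a → Φ x a * (w x y * discrepancy Ψ x y a)))
      ≈⟨ sum-cong {n} (λ y → sum-cong {d} (λ a →
           solve 3 (λ f w t → f :* (w :* t) := w :* (f :* t)) refl (Φ x a) (w x y) (discrepancy Ψ x y a))) ⟩
    sum (λ y → sum (λ a → w x y * (Φ x a * discrepancy Ψ x y a)))
      ≈⟨ sum-cong {n} (λ y → *-distribˡ-sum (w x y) (λ a → Φ x a * discrepancy Ψ x y a)) ⟨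
    sum (λ y → w x y * dot (Φ x) (discrepancy Ψ x y)) ∎

  -- The degree part is a symmetric dot product. In the transport part, exchanging the names of the
  -- endpoints turns each transport into its adjoint.
  laplacian-selfAdjoint : ∀ (Φ Ψ : Section) → ⟪ Φ , laplacian Ψ ⟫ ≈ ⟪ Ψ , laplacian Φ ⟫
  laplacian-selfAdjoint Φ Ψ = begin
    ⟪ Φ , laplacian Ψ ⟫
      ≈⟨ expand Φ Ψ ⟩
    sum (λ x → sum (λ y → w x y * dot (Φ x) (Ψ x))) - sum (λ x → sum (λ y → w x y * dot (Φ x) (transport x y (Ψ y))))
      ≈⟨ +-cong (sum-cong {n} (λ x → sum-cong {n} (λ y → *-congˡ (dot-comm (Φ x) (Ψ x))))) (-‿cong (begin
           sum (λ x → sum (λ y → w x y * dot (Φ x) (transport x y (Ψ y))))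
             ≈⟨ ∑-comm {n} {n} (λ x y → w x y * dot (Φ x) (transport x y (Ψ y))) ⟩
           sum (λ y → sum (λ x → w x y * dot (Φ x) (transport x y (Ψ y))))
             ≈⟨ sum-cong {n} (λ y → sum-cong {n} (λ x → *-cong (w-symmetric x y) (trans
                  (transport-adjoint x y (Φ x) (Ψ y)) (dot-comm (transport y x (Φ x)) (Ψ y))))) ⟩
           sum (λ y → sum (λ x → w y x * dot (Ψ y) (transport y x (Φ x)))) ∎)) ⟩
    sum (λ x → sum (λ y → w x y * dot (Ψ x) (Φ x))) - sum (λ x → sum (λ y → w x y * dot (Ψ x) (transport x y (Φ y))))
      ≈⟨ expand Ψ Φ ⟨
    ⟪ Ψ , laplacian Φ ⟫ ∎
    where
    expand : ∀ (Φ Ψ : Section) → ⟪ Φ , laplacian Ψ ⟫ ≈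
      sum (λ x → sum (λ y → w x y * dot (Φ x) (Ψ x))) - sum (λ x → sum (λ y → w x y * dot (Φ x) (transport x y (Ψ y))))
    expand Φ Ψ = begin
      ⟪ Φ , laplacian Ψ ⟫
        ≈⟨ ⟪,⟫-laplacian Φ Ψ ⟩
      sum (λ x → sum (λ y → w x y * dot (Φ x) (discrepancy Ψ x y)))
        ≈⟨ sum-cong {n} (λ x → trans
             (sum-cong {n} (λ y → trans (*-congˡ (dot-subʳ (Φ x) (Ψ x) (transport x y (Ψ y))))
               (solve 3 (λ w p q → w :* (p :- q) := w :* p :- w :* q) refl
                 (w x y) (dot (Φ x) (Ψ x)) (dot (Φ x) (transport x y (Ψ y))))))
             (sum-sub (λ y → w x y * dot (Φ x) (Ψ x)) (λ y → w x y * dot (Φ x) (transport x y (Ψ y))))) ⟩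
      sum (λ x → sum (λ y → w x y * dot (Φ x) (Ψ x)) - sum (λ y → w x y * dot (Φ x) (transport x y (Ψ y))))
        ≈⟨ sum-sub (λ x → sum (λ y → w x y * dot (Φ x) (Ψ x)))
                   (λ x → sum (λ y → w x y * dot (Φ x) (transport x y (Ψ y)))) ⟩
      sum (λ x → sum (λ y → w x y * dot (Φ x) (Ψ x))) - sum (λ x → sum (λ y → w x y * dot (Φ x) (transport x y (Ψ y)))) ∎

  -- Carried isometrically into the fibre over `x`, the discrepancy seen from `y` is the negative of
  -- the one seen from `x`. Hence the two orientations of an edge add up to a square in `energy`.
  discrepancy-reverse : ∀ (Φ : Section) {x y} → x ~ y →
    dot (Φ y) (discrepancy Φ y x) ≈ - dot (transport x y (Φ y)) (discrepancy Φ x y)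
  discrepancy-reverse Φ {x} {y} x~y = begin
    dot (Φ y) (discrepancy Φ y x)
      ≈⟨ dot-subʳ (Φ y) (Φ y) (transport y x (Φ x)) ⟩
    dot (Φ y) (Φ y) - dot (Φ y) (transport y x (Φ x))
      ≈⟨ +-cong (sym (transport-isometry x~y (Φ y))) (-‿cong (transport-adjoint y x (Φ y) (Φ x))) ⟩
    dot T T - dot T (Φ x)
      ≈⟨ solve 2 (λ p q → p :- q := :- (q :- p)) refl (dot T T) (dot T (Φ x)) ⟩
    - (dot T (Φ x) - dot T T)
      ≈⟨ -‿cong (dot-subʳ T (Φ x) T) ⟨
    - dot T (discrepancy Φ x y) ∎
    where
    T = transport x y (Φ y)

  energy : ∀ (Φ : Section) → (1# + 1#) * ⟪ Φ , laplacian Φ ⟫ ≈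
    sum (λ x → sum (λ y → w x y * dot (discrepancy Φ x y) (discrepancy Φ x y)))
  energy Φ = begin
    (1# + 1#) * ⟪ Φ , laplacian Φ ⟫
      ≈⟨ solve 1 (λ e → (1: :+ 1:) :* e := e :+ e) refl ⟪ Φ , laplacian Φ ⟫ ⟩
    ⟪ Φ , laplacian Φ ⟫ + ⟪ Φ , laplacian Φ ⟫
      ≈⟨ +-cong (⟪,⟫-laplacian Φ Φ) (trans (⟪,⟫-laplacian Φ Φ)
           (∑-comm {n} {n} (λ x y → w x y * dot (Φ x) (discrepancy Φ x y)))) ⟩
    sum (λ x → sum (λ y → w x y * dot (Φ x) (discrepancy Φ x y))) +
      sum (λ x → sum (λ y → w y x * dot (Φ y) (discrepancy Φ y x)))
      ≈⟨ trans
           (sum-cong {n} (λ x → ∑-distrib-+ {n} (λ y → w x y * dot (Φ x) (discrepancy Φ x y))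
                                        (λ y → w y x * dot (Φ y) (discrepancy Φ y x))))
           (∑-distrib-+ {n} (λ x → sum (λ y → w x y * dot (Φ x) (discrepancy Φ x y)))
                        (λ x → sum (λ y → w y x * dot (Φ y) (discrepancy Φ y x)))) ⟨
    sum (λ x → sum (λ y → w x y * dot (Φ x) (discrepancy Φ x y) + w y x * dot (Φ y) (discrepancy Φ y x)))
      ≈⟨ sum-cong {n} (λ x → sum-cong {n} (λ y → combineTerms x y)) ⟩
    sum (λ x → sum (λ y → w x y * dot (discrepancy Φ x y) (discrepancy Φ x y))) ∎
    where
    combineTerms : ∀ x y →
      w x y * dot (Φ x) (discrepancy Φ x y) + w y x * dot (Φ y) (discrepancy Φ y x) ≈
      w x y * dot (discrepancy Φ x y) (discrepancy Φ x y)
    combineTerms x y = begin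
      w x y * dot (Φ x) D + w y x * dot (Φ y) (discrepancy Φ y x)
        ≈⟨ +-congˡ (trans (*-congʳ (w-symmetric y x)) (w-*-cong x y (discrepancy-reverse Φ))) ⟩
      w x y * dot (Φ x) D + w x y * - dot (transport x y (Φ y)) D
        ≈⟨ distribˡ _ _ _ ⟨
      w x y * (dot (Φ x) D - dot (transport x y (Φ y)) D)
        ≈⟨ *-congˡ (dot-subˡ (Φ x) (transport x y (Φ y)) D) ⟨
      w x y * dot D D ∎
      where
      D = discrepancy Φ x y

  energy-pos : ∀ (Φ : Section) x a → laplacian Φ x a # 0# → 0# < ⟪ Φ , laplacian Φ ⟫
  energy-pos Φ x a LΦ#0 with sum#0⇒term#0 (λ y → w x y * discrepancy Φ x y a)
                                (#-congʳ (laplacian-discrepancy Φ x a) LΦ#0)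
  ... | y , wD#0 = *-cancelˡ-pos 0<2 (<-respʳ-≈ (sym (energy Φ))
    (sum-pos (λ x → sum (terms x)) (λ x → sum-nonneg (terms x) (terms-nonneg x)) x
      (sum-pos (terms x) (terms-nonneg x) y
        -- Both factors of the nonzero term are apart from zero: the weight is therefore positive,
        -- and coordinate `a` of the discrepancy has a positive square.
        (*-pos (#0∧nonneg⇒pos (*#0⇒#0ˡ wD#0) (w-nonneg x y))
               (sum-pos (squares x y) (squares-nonneg x y) a (#0⇒0<square (*#0⇒#0ʳ wD#0)))))))
    where
    squares : Fin n → Fin n → Fin d → ℝ
    squares x y a = discrepancy Φ x y a * discrepancy Φ x y a
    squares-nonneg : ∀ x y a → 0# ≤ squares x y a
    squares-nonneg x y a = 0≤square (discrepancy Φ x y a)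
    terms : Fin n → Fin n → ℝ
    terms x y = w x y * sum (squares x y)
    terms-nonneg : ∀ x y → 0# ≤ terms x y
    terms-nonneg x y = *-nonneg (w-nonneg x y) (sum-nonneg (squares x y) (squares-nonneg x y))

  connectionLaplacian-symmetric : Symmetric connectionLaplacian
  connectionLaplacian-symmetric r s = blockSymmetric (proj₁ (remQuot {n} d r)) (proj₁ (remQuot {n} d s))
                                                     (proj₂ (remQuot {n} d r)) (proj₂ (remQuot {n} d s))
    where
    blockSymmetric : ∀ x y a b → laplacianBlock y x b a ≈ laplacianBlock x y a b
    blockSymmetric x y a b with x ≟ y | y ≟ x
    ... | yes ≡.refl | yes _    = *-congˡ (I-symmetric b a)
    ... | yes ≡.refl | no y≢x   = ⊥-elim (y≢x ≡.refl)
    ... | no x≢y | yes ≡.refl   = ⊥-elim (x≢y ≡.refl)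
    ... | no _       | no _     = *-cong (-‿cong (w-symmetric y x)) (σ₀-transpose y x b a)

  connectionLaplacian-act : ∀ (v : Fin (n ℕ.* d) → ℝ) r →
    sum (λ s → connectionLaplacian r s * v s) ≈
    laplacian (λ y b → v (combine y b)) (proj₁ (remQuot {n} d r)) (proj₂ (remQuot {n} d r))
  connectionLaplacian-act v r = trans (sum-combine n (λ s → connectionLaplacian r s * v s))
    (sum-cong {n} (λ y → sum-cong {d} (λ b → *-congʳ (reflexive (≡.cong
      (λ (y , b) → laplacianBlock (proj₁ (remQuot {n} d r)) y (proj₂ (remQuot {n} d r)) b)
      (remQuot-combine y b))))))

  I-combine : ∀ (r s : Fin (n ℕ.* d)) → let (x , a) = remQuot {n} d r; (y , b) = remQuot {n} d s in
    (if does (x ≟ y) then I a b else 0#) ≈ I r s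
  I-combine r s with r ≟ s
  ... | yes ≡.refl = diagonal (remQuot {n} d r)
    where
    diagonal : ∀ ((x , a) : Fin n × Fin d) → (if does (x ≟ x) then I a a else 0#) ≈ 1#
    diagonal (x , a) with x ≟ x | a ≟ a
    ... | yes _  | yes _  = refl
    ... | yes _  | no a≢a = ⊥-elim (a≢a ≡.refl)
    ... | no x≢x | _      = ⊥-elim (x≢x ≡.refl)
  ... | no r≢s = offDiagonal (remQuot {n} d r) (remQuot {n} d s) λ p≡q → r≢s
    (≡.trans (≡.sym (combine-remQuot {n} d r))
      (≡.trans (≡.cong (λ (x , a) → combine x a) p≡q) (combine-remQuot {n} d s)))
    where
    offDiagonal : ∀ ((x , a) (y , b) : Fin n × Fin d) → ¬ ((x , a) ≡ (y , b)) →
      (if does (x ≟ y) then I a b else 0#) ≈ 0#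
    offDiagonal (x , a) (y , b) p≢q with x ≟ y | a ≟ b
    ... | yes ≡.refl | yes ≡.refl = ⊥-elim (p≢q ≡.refl)
    ... | yes _      | no _       = refl
    ... | no _       | _          = refl

  solvable⇒absolutelyInconsistent :
    (∀ y b → Σ[ Φ ∈ Section ] (∀ x a → laplacian Φ x a ≈ (if does (x ≟ y) then I a b else 0#))) →
    AbsolutelyInconsistent
  solvable⇒absolutelyInconsistent solve-δ = symmetric-rightInverse⇒Invertible connectionLaplacian M
    connectionLaplacian-symmetric LM≈I
    where
    Φ : Fin (n ℕ.* d) → Section
    Φ s = proj₁ (solve-δ (proj₁ (remQuot {n} d s)) (proj₂ (remQuot {n} d s)))
    M : Matrix (n ℕ.* d) (n ℕ.* d)
    M r s = Φ s (proj₁ (remQuot {n} d r)) (proj₂ (remQuot {n} d r))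
    LM≈I : connectionLaplacian · M ≋ I
    LM≈I r s = begin
      sum (λ t → connectionLaplacian r t * M t s)
        ≈⟨ connectionLaplacian-act (λ t → M t s) r ⟩
      laplacian (λ y b → M (combine y b) s) x a
        ≈⟨ laplacian-cong (λ y b → reflexive (≡.cong (λ (y , b) → Φ s y b) (remQuot-combine y b))) x a ⟩
      laplacian (Φ s) x a
        ≈⟨ proj₂ (solve-δ (proj₁ (remQuot {n} d s)) (proj₂ (remQuot {n} d s))) x a ⟩
      (if does (x ≟ proj₁ (remQuot {n} d s)) then I a (proj₂ (remQuot {n} d s)) else 0#)
        ≈⟨ I-combine r s ⟩
      I r s ∎
      where
      x = proj₁ (remQuot {n} d r)
      a = proj₂ (remQuot {n} d r)

  -- Since Φ = M (L Φ) for the left inverse `M`, a nonzero entry of `Φ` is a nonzero sum of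
  -- multiples of entries of L Φ.
  absolutelyInconsistent⇒energy-pos : AbsolutelyInconsistent →
    ∀ (Φ : Section) x a → Φ x a # 0# → 0# < ⟪ Φ , laplacian Φ ⟫
  absolutelyInconsistent⇒energy-pos (M , ML≈I , _) Φ x a Φ#0 =
    positive (sum#0⇒term#0 (λ t → M r t * sum (λ s → connectionLaplacian t s * v s)) (#-congʳ expand Φ#0))
    where
    r = combine x a
    v : Fin (n ℕ.* d) → ℝ
    v s = Φ (proj₁ (remQuot {n} d s)) (proj₂ (remQuot {n} d s))
    v-combine : ∀ y b → v (combine y b) ≈ Φ y b
    v-combine y b = reflexive (≡.cong (λ (y , b) → Φ y b) (remQuot-combine y b))
    expand : Φ x a ≈ sum (λ t → M r t * sum (λ s → connectionLaplacian t s * v s))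
    expand = begin
      Φ x a
        ≈⟨ v-combine x a ⟨
      v r
        ≈⟨ I-act v r ⟨
      sum (λ s → I r s * v s)
        ≈⟨ sum-cong (λ s → *-congʳ (ML≈I r s)) ⟨
      sum (λ s → sum (λ t → M r t * connectionLaplacian t s) * v s)
        ≈⟨ *-sum-assoc (M r) connectionLaplacian v ⟨
      sum (λ t → M r t * sum (λ s → connectionLaplacian t s * v s)) ∎
    positive : ∃[ t ] (M r t * sum (λ s → connectionLaplacian t s * v s) # 0#) → 0# < ⟪ Φ , laplacian Φ ⟫
    positive (t , term#0) = energy-pos Φ y b (#-congʳ
      (trans (connectionLaplacian-act v t) (laplacian-cong v-combine y b)) (*#0⇒#0ʳ term#0))
      where
      y = proj₁ (remQuot {n} d t)
      b = proj₂ (remQuot {n} d t)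

-- Hitting times of finite Markov chains.

uniformBound : ∀ {ℓ n} (P : ℕ → Fin n → Set ℓ) → (∀ {M N} → M ℕ.≤ N → ∀ x → P M x → P N x) →
  (∀ x → ∃[ N ] P N x) → ∃[ N ] (∀ x → P N x)
uniformBound {n = zero}  P P-mono bound = 0 , λ ()
uniformBound {n = suc n} P P-mono bound
  with bound zero | uniformBound (λ N x → P N (suc x)) (λ M≤N x → P-mono M≤N (suc x)) (λ x → bound (suc x))
... | M , P₀ | N , Pₛ = M ℕ.⊔ N , λ where
  zero    → P-mono (ℕ.m≤m⊔n M N) zero P₀
  (suc x) → P-mono (ℕ.m≤n⊔m M N) (suc x) (Pₛ x)

module FirstPassage {c ℓ₁ ℓ₂ ℓ₃} (𝓡 : RealNumbers c ℓ₁ ℓ₂ ℓ₃) {n : ℕ}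
  (p : Fin n → Fin n → RealNumbers.ℝ 𝓡)
  (0≤p : ∀ x y → RealNumbers._≤_ 𝓡 (RealNumbers.0# 𝓡) (p x y))
  (Σp≈1 : ∀ x → RealNumbers._≈_ 𝓡 (RealNumbers.sum 𝓡 (p x)) (RealNumbers.1# 𝓡))
  (i : Fin n) where
  open RealNumbers 𝓡
  open OrderedFieldProperties 𝓡
  open FiniteSums 𝓡
  open Limits 𝓡
  open SetoidReasoning setoid

  killed : (Fin n → ℝ) → Fin n → ℝ
  killed f y = if does (y ≟ i) then 0# else f y

  -- The transition operator of the chain killed on arrival at `i`. Only the target is tested, so a
  -- walk may start at `i`, and return times are treated together with hitting times.
  step : (Fin n → ℝ) → Fin n → ℝ
  step f x = sum (λ y → p x y * killed f y)

  -- survival k x is the probability that the chain started at x avoids i at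
  -- the times 1, …, k; firstPassage k x that it first hits i at time k + 1.

  survival : ℕ → Fin n → ℝ
  survival zero    = λ _ → 1#
  survival (suc k) = step (survival k)

  firstPassage : ℕ → Fin n → ℝ
  firstPassage zero    = λ x → p x i
  firstPassage (suc k) = step (firstPassage k)

  killed-scale-≤ : ∀ s t {f g : Fin n → ℝ} y → s * f y ≤ t * g y → s * killed f y ≤ t * killed g y
  killed-scale-≤ s t y sf≤tg with does (y ≟ i)
  ... | true  = ≤-reflexive (trans (zeroʳ s) (sym (zeroʳ t)))
  ... | false = sf≤tg

  -- Scalars on both sides let bounds with cleared denominators be iterated without division.
  step-scale-≤ : ∀ s t {f g : Fin n → ℝ} → (∀ y → s * f y ≤ t * g y) → ∀ x → s * step f x ≤ t * step g x
  step-scale-≤ s t {f} {g} sf≤tg x = ≤-respˡ (exchange s f) (≤-respʳ (exchange t g)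
    (sum-mono-≤ (λ y → p x y * (s * killed f y)) (λ y → p x y * (t * killed g y))
      (λ y → *-monoʳ-≤ (0≤p x y) (killed-scale-≤ s t {f} {g} y (sf≤tg y)))))
    where
    exchange : ∀ s f → sum (λ y → p x y * (s * killed f y)) ≈ s * step f x
    exchange s f = trans
      (sum-cong (λ y → solve 3 (λ p s f → p :* (s :* f) := s :* (p :* f)) refl (p x y) s (killed f y)))
      (sym (*-distribˡ-sum s (λ y → p x y * killed f y)))

  step-mono-≤ : ∀ {f g : Fin n → ℝ} → (∀ y → f y ≤ g y) → ∀ x → step f x ≤ step g x
  step-mono-≤ {f} {g} f≤g x = ≤-respˡ (*-identityˡ (step f x)) (≤-respʳ (*-identityˡ (step g x))
    (step-scale-≤ 1# 1# {f} {g} (λ y → ≤-respˡ (sym (*-identityˡ (f y))) (≤-respʳ (sym (*-identityˡ (g y))) (f≤g y))) x))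

  -- As the rows of `p` sum to `1#`, upper bounds on `step f` become statements about a sum of
  -- nonnegative terms.
  step-complement : ∀ (f : Fin n → ℝ) x → sum (λ y → p x y * (1# - killed f y)) ≈ 1# - step f x
  step-complement f x = begin
    sum (λ y → p x y * (1# - killed f y))
      ≈⟨ sum-cong (λ y → solve 2 (λ p k → p :* (1: :- k) := p :- p :* k) refl (p x y) (killed f y)) ⟩
    sum (λ y → p x y - p x y * killed f y)
      ≈⟨ sum-sub (p x) (λ y → p x y * killed f y) ⟩
    sum (p x) - step f x
      ≈⟨ +-congʳ (Σp≈1 x) ⟩
    1# - step f x ∎

  killed≤1 : ∀ {f : Fin n → ℝ} → (∀ y → f y ≤ 1#) → ∀ y → killed f y ≤ 1#
  killed≤1 f≤1 y with does (y ≟ i)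
  ... | true  = <⇒≤ 0<1
  ... | false = f≤1 y

  step≤1 : ∀ {f : Fin n → ℝ} → (∀ y → f y ≤ 1#) → ∀ x → step f x ≤ 1#
  step≤1 {f} f≤1 x = 0≤-⇒≤ (≤-respʳ (step-complement f x)
    (sum-nonneg (λ y → p x y * (1# - killed f y))
      (λ y → *-nonneg (0≤p x y) (≤⇒0≤- (killed≤1 {f} f≤1 y)))))

  survival≤1 : ∀ k x → survival k x ≤ 1#
  survival≤1 zero    x = ≤-reflexive refl
  survival≤1 (suc k) x = step≤1 (survival≤1 k) x

  killed-nonneg : ∀ {f : Fin n → ℝ} → (∀ y → 0# ≤ f y) → ∀ y → 0# ≤ killed f y
  killed-nonneg 0≤f y with does (y ≟ i)
  ... | true  = ≤-reflexive refl
  ... | false = 0≤f y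

  step-nonneg : ∀ {f : Fin n → ℝ} → (∀ y → 0# ≤ f y) → ∀ x → 0# ≤ step f x
  step-nonneg {f} 0≤f x = sum-nonneg (λ y → p x y * killed f y)
    (λ y → *-nonneg (0≤p x y) (killed-nonneg 0≤f y))

  0≤survival : ∀ k x → 0# ≤ survival k x
  0≤survival zero    x = <⇒≤ 0<1
  0≤survival (suc k) x = step-nonneg (0≤survival k) x

  survival-suc-≤ : ∀ k x → survival (suc k) x ≤ survival k x
  survival-suc-≤ zero    x = step≤1 (λ _ → ≤-reflexive refl) x
  survival-suc-≤ (suc k) x = step-mono-≤ (survival-suc-≤ k) x

  killed-mono-≤ : ∀ {f g : Fin n → ℝ} y → f y ≤ g y → killed f y ≤ killed g y
  killed-mono-≤ y f≤g with does (y ≟ i)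
  ... | true  = ≤-reflexive refl
  ... | false = f≤g

  complement-mono : ∀ {a b : ℝ} → b ≤ a → 1# - a ≤ 1# - b
  complement-mono {a} {b} b≤a = 0≤-⇒≤ (≤-respʳ
    (solve 2 (λ a b → a :- b := (1: :- b) :- (1: :- a)) refl a b) (≤⇒0≤- b≤a))

  killed-survival-antitone : ∀ y {M N} → M ℕ.≤ N → 1# - killed (survival M) y ≤ 1# - killed (survival N) y
  killed-survival-antitone y = monotone (λ k → 1# - killed (survival k) y) (λ k →
    complement-mono (killed-mono-≤ {survival (suc k)} {survival k} y (survival-suc-≤ k y)))

  survival-antitone : ∀ x {M N} → M ℕ.≤ N → survival N x ≤ survival M x
  survival-antitone x {M} {N} M≤N = 0≤-⇒≤ (≤-respʳ
    (solve 2 (λ a b → (1: :- b) :- (1: :- a) := a :- b) refl (survival M x) (survival N x))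
    (≤⇒0≤- (monotone (λ k → 1# - survival k x) (λ k → complement-mono (survival-suc-≤ k x)) M≤N)))

  -- The Markov property as an inequality: a bound for the last `k` steps that is uniform in their
  -- starting point factors out of the survival of the first `m`.
  survival-+ : ∀ {s t} k → (∀ y → s * survival k y ≤ t) →
    ∀ m x → s * survival (m ℕ.+ k) x ≤ t * survival m x
  survival-+ {s} {t} k bound zero    x = ≤-respʳ (sym (*-identityʳ t)) (bound x)
  survival-+ {s} {t} k bound (suc m) x =
    step-scale-≤ s t {survival (m ℕ.+ k)} {survival m} (survival-+ k bound m) x

  -- The chain started at x visits i within m steps with probability at least 1/m.
  UniformHit : ℕ → Fin n → Set ℓ₃
  UniformHit m x = 1# ≤ fromℕ m * (1# - killed (survival m) x)

  module _ {_~_ : Rel (Fin n) 0ℓ} (p-pos : ∀ {x y} → x ~ y → 0# < p x y) where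

    -- Outer `killed` counts a start at `i` as a hit at time 0, which is the base case. Prepending
    -- an edge keeps the survival below `1#`, because that edge is taken with positive probability.
    path⇒killed<1 : ∀ {x} → Star _~_ x i → ∃[ k ] (killed (survival k) x < 1#)
    path⇒killed<1 ε = 0 , at-i
      where
      at-i : killed (survival 0) i < 1#
      at-i with i ≟ i
      ... | yes _  = 0<1
      ... | no i≢i = ⊥-elim (i≢i ≡.refl)
    path⇒killed<1 {x} (_◅_ {j = y} x~y path) with path⇒killed<1 path
    ... | k , killed<1 = suc k , killed-suc<1
      where
      step<1 : step (survival k) x < 1#
      step<1 = 0<-⇒< (<-respʳ-≈ (step-complement (survival k) x)
        (sum-pos (λ z → p x z * (1# - killed (survival k) z))
          (λ z → *-nonneg (0≤p x z) (≤⇒0≤- (killed≤1 (survival≤1 k) z)))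
          y (*-pos (p-pos x~y) (<⇒0<- killed<1))))
      killed-suc<1 : killed (survival (suc k)) x < 1#
      killed-suc<1 with does (x ≟ i)
      ... | true  = 0<1
      ... | false = step<1

    path⇒hit : ∀ {x} → Star _~_ x i → ∃[ m ] UniformHit m x
    path⇒hit {x} path with path⇒killed<1 path
    ... | k , killed<1 with ∃-quotient (<⇒0<- killed<1) 0<1
    ... | δ , _ , κδ≈1 with archimedean δ
    -- The same number is the number of steps and the denominator of the probability, so it must
    -- reach both `k` and a bound for `δ`, the inverse of the hitting probability.
    ... | M , δ<M = M ℕ.⊔ k , ≤-respˡ κδ≈1 (≤-trans
      (*-monoʳ-≤ (<⇒≤ (<⇒0<- killed<1)) (≤-trans (<⇒≤ δ<M) (fromℕ-mono-≤ (ℕ.m≤m⊔n M k))))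
      (≤-respˡ (*-comm (fromℕ (M ℕ.⊔ k)) (1# - killed (survival k) x))
        (*-monoʳ-≤ (0≤fromℕ (M ℕ.⊔ k)) (killed-survival-antitone x (ℕ.m≤n⊔m M k)))))

    UniformHit-mono : ∀ {M N} → M ℕ.≤ N → ∀ x → UniformHit M x → UniformHit N x
    UniformHit-mono {M} {N} M≤N x hit = ≤-trans hit (≤-trans
      (*-monoʳ-≤ (0≤fromℕ M) (killed-survival-antitone x M≤N))
      (≤-respˡ (*-comm κ (fromℕ M)) (≤-respʳ (*-comm κ (fromℕ N)) (*-monoʳ-≤ 0≤κ (fromℕ-mono-≤ M≤N)))))
      where
      κ = 1# - killed (survival N) x
      0≤κ : 0# ≤ κ
      0≤κ = ≤⇒0≤- (killed≤1 (survival≤1 N) x)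

    module _ (connected : ∀ x y → Star _~_ x y) where

      -- `UniformHit` counts time 0, whereas `survival` looks at positive times only. The estimate
      -- is therefore applied after one step, which accounts for `suc m`.
      survival-hit : ∀ m → (∀ x → UniformHit m x) → ∀ x → fromℕ m * survival (suc m) x ≤ fromℕ m - 1#
      survival-hit m hit x = 0≤-⇒≤ (≤-respʳ eq (sum-nonneg terms terms-nonneg))
        where
        κ = killed (survival m)
        terms : Fin n → ℝ
        terms y = p x y * (fromℕ m * (1# - κ y) - 1#)
        terms-nonneg : ∀ y → 0# ≤ terms y
        terms-nonneg y = *-nonneg (0≤p x y) (≤⇒0≤- (hit y))
        eq : sum terms ≈ (fromℕ m - 1#) - fromℕ m * survival (suc m) x
        eq = begin
          sum terms
            ≈⟨ sum-cong (λ y → solve 3 (λ p m κ → p :* (m :* (1: :- κ) :- 1:) := m :* (p :* (1: :- κ)) :- p)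
                 refl (p x y) (fromℕ m) (κ y)) ⟩
          sum (λ y → fromℕ m * (p x y * (1# - κ y)) - p x y)
            ≈⟨ sum-sub (λ y → fromℕ m * (p x y * (1# - κ y))) (p x) ⟩
          sum (λ y → fromℕ m * (p x y * (1# - κ y))) - sum (p x)
            ≈⟨ +-cong (trans (sym (*-distribˡ-sum (fromℕ m) (λ y → p x y * (1# - κ y))))
                             (*-congˡ (step-complement (survival m) x)))
                      (-‿cong (Σp≈1 x)) ⟩
          fromℕ m * (1# - survival (suc m) x) - 1#
            ≈⟨ solve 2 (λ m u → m :* (1: :- u) :- 1: := (m :- 1:) :- m :* u) refl
                 (fromℕ m) (survival (suc m) x) ⟩
          (fromℕ m - 1#) - fromℕ m * survival (suc m) x ∎

      -- This is the inequality (1 - 1/m)ʲ ≤ m / (m + j).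
      survival-decay : ∀ m → (∀ x → UniformHit m x) →
        ∀ j x → (fromℕ m + fromℕ j) * survival (j ℕ.* suc m) x ≤ fromℕ m
      survival-decay m hit zero    x = ≤-reflexive
        (solve 1 (λ m → (m :+ 0:) :* 1: := m) refl (fromℕ m))
      survival-decay m hit (suc j) x = ≤-respˡ
        (solve 3 (λ m j u → (m :+ j) :* u :+ u := (m :+ (1: :+ j)) :* u) refl
          (fromℕ m) (fromℕ j) (survival (suc j ℕ.* suc m) x))
        (≤-respʳ (solve 1 (λ m → (m :- 1:) :+ 1: := m) refl (fromℕ m))
          -- With u the new survival probability, the first inequality is (m + j) u ≤ m - 1. Adding
          -- u ≤ 1 raises the factor to m + j + 1 and the bound to m.
          (+-mono-≤
            (≤-trans (survival-+ (j ℕ.* suc m) (survival-decay m hit j) (suc m) x) (survival-hit m hit x))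
            (survival≤1 (suc j ℕ.* suc m) x)))

      -- Here `δ` is 1/e, so e j exceeds m, and (m + j)(e - u) is the sum of the positive e j - m
      -- and the nonnegative terms e m and m - (m + j) u.
      quotient-< : ∀ {e δ m j u} → 0# < e → 0# < δ → e * δ ≈ 1# → 0# ≤ m → δ * m < j →
                   (m + j) * u ≤ m → u < e
      quotient-< {e} {δ} {m} {j} {u} 0<e 0<δ eδ≈1 0≤m δm<j bound =
        0<-⇒< (*-cancelˡ-pos (nonneg+pos 0≤m (≤-<-trans (*-nonneg (<⇒≤ 0<δ) 0≤m) δm<j))
          (<-respʳ-≈ (solve 4 (λ m j e u → (e :* j :- m) :+ e :* m :+ (m :- (m :+ j) :* u) := (m :+ j) :* (e :- u))
              refl m j e u)
            (pos+nonneg (pos+nonneg (<⇒0<- m<ej) (*-nonneg (<⇒≤ 0<e) 0≤m)) (≤⇒0≤- bound))))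
        where
        m<ej : m < e * j
        m<ej = <-respˡ-≈ (trans (sym (*-assoc e δ m)) (trans (*-congʳ eδ≈1) (*-identityˡ m)))
          (0<-⇒< (<-respʳ-≈ (solve 4 (λ e j δ m → e :* (j :- δ :* m) := e :* j :- e :* (δ :* m)) refl e j δ m)
            (*-pos 0<e (<⇒0<- δm<j))))

      eventually-small : ∀ x {e} K → 0# < e → survival K x < e →
                         ∀ k → K ℕ.≤ k → Within e (survival k x) 0#
      eventually-small x K 0<e small k K≤k =
        <-respˡ-≈ (solve 1 (λ u → u := u :- 0:) refl (survival k x)) (≤-<-trans (survival-antitone x K≤k) small) ,
        ≤-<-trans (0≤-⇒≤ (≤-respʳ (solve 1 (λ u → u := 0: :- (0: :- u)) refl (survival k x)) (0≤survival k x))) 0<e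

      survival-vanishes : ∀ x → ConvergesTo (λ k → survival k x) 0#
      survival-vanishes x e 0<e =
        let m , hit        = uniformBound UniformHit UniformHit-mono (λ y → path⇒hit (connected y i))
            δ , 0<δ , eδ≈1 = ∃-quotient 0<e 0<1
            j , δm<j       = archimedean (δ * fromℕ m)
        in j ℕ.* suc m , eventually-small x (j ℕ.* suc m) 0<e
             (quotient-< 0<e 0<δ eδ≈1 (0≤fromℕ m) δm<j (survival-decay m hit j x))

  -- A first hit at time k + 1 means surviving `k` steps but not k + 1. In this form the partial
  -- sums telescope.
  firstPassage-survival : ∀ k x → firstPassage k x ≈ survival k x - survival (suc k) x
  firstPassage-survival zero x = begin
    p x i
      ≈⟨ sum-select i (p x) ⟨
    sum (λ y → if does (y ≟ i) then p x y else 0#)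
      ≈⟨ sum-cong hit ⟩
    sum (λ y → p x y * (1# - killed (λ _ → 1#) y))
      ≈⟨ step-complement (λ _ → 1#) x ⟩
    1# - step (λ _ → 1#) x ∎
    where
    hit : ∀ y → (if does (y ≟ i) then p x y else 0#) ≈ p x y * (1# - killed (λ _ → 1#) y)
    hit y with does (y ≟ i)
    ... | true  = solve 1 (λ p → p := p :* (1: :- 0:)) refl (p x y)
    ... | false = solve 1 (λ p → 0: := p :* (1: :- 1:)) refl (p x y)
  firstPassage-survival (suc k) x = begin
    step (firstPassage k) x
      ≈⟨ sum-cong difference ⟩
    sum (λ y → p x y * killed (survival k) y - p x y * killed (survival (suc k)) y)
      ≈⟨ sum-sub (λ y → p x y * killed (survival k) y) (λ y → p x y * killed (survival (suc k)) y) ⟩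
    step (survival k) x - step (survival (suc k)) x ∎
    where
    difference : ∀ y → p x y * killed (firstPassage k) y ≈
                 p x y * killed (survival k) y - p x y * killed (survival (suc k)) y
    difference y with does (y ≟ i)
    ... | true  = solve 1 (λ p → p :* 0: := p :* 0: :- p :* 0:) refl (p x y)
    ... | false = trans (*-congˡ (firstPassage-survival k y))
      (solve 3 (λ p s t → p :* (s :- t) := p :* s :- p :* t) refl (p x y) (survival k y) (survival (suc k) y))

  partialSum-firstPassage : ∀ N x → partialSum (λ k → firstPassage k x) N ≈ 1# - survival N x
  partialSum-firstPassage zero    x = sym (-‿inverseʳ 1#)
  partialSum-firstPassage (suc N) x = begin
    partialSum (λ k → firstPassage k x) (suc N)
      ≈⟨ partialSum-suc (λ k → firstPassage k x) N ⟩
    partialSum (λ k → firstPassage k x) N + firstPassage N x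
      ≈⟨ +-cong (partialSum-firstPassage N x) (firstPassage-survival N x) ⟩
    (1# - survival N x) + (survival N x - survival (suc N) x)
      ≈⟨ solve 2 (λ s t → (1: :- s) :+ (s :- t) := 1: :- t) refl (survival N x) (survival (suc N) x) ⟩
    1# - survival (suc N) x ∎

  firstPassage-sums : ∀ x → ConvergesTo (λ k → survival k x) 0# → SumsTo (λ k → firstPassage k x) 1#
  firstPassage-sums x vanishes = ConvergesTo-cong
    {λ k → 1# + - 1# * survival k x} {partialSum (λ k → firstPassage k x)} {1# + - 1# * 0#} {1#}
    (λ N → trans (solve 1 (λ s → 1: :+ (:- 1:) :* s := 1: :- s) refl (survival N x))
                 (sym (partialSum-firstPassage N x)))
    (solve 0 (1: :+ (:- 1:) :* 0: := 1:) refl)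
    (ConvergesTo-+ (ConvergesTo-const 1#) (ConvergesTo-*ˡ (- 1#) vanishes))

-- Transition probabilities and sums over paths.

module RandomWalk {c ℓ₁ ℓ₂ ℓ₃} (𝓡 : RealNumbers c ℓ₁ ℓ₂ ℓ₃)
  {n d : ℕ} (Γ : Graphs.ConnectionGraph 𝓡 n d) where
  open RealNumbers 𝓡
  open OrderedFieldProperties 𝓡
  open FiniteSums 𝓡
  open Graphs.ConnectionGraph Γ
  open Connection 𝓡 Γ
  open Degrees 𝓡 using (deg-pos; deg#0)
  open ConnectionProperties 𝓡 Γ using (w-nonedge)
  open SetoidReasoning setoid

  deg-*-p : ∀ x y → deg x * p x y ≈ w x y
  deg-*-p x y = begin
    deg x * (w x y * recip (deg#0 graph x))
      ≈⟨ solve 3 (λ d w r → d :* (w :* r) := (d :* r) :* w) refl (deg x) (w x y) (recip (deg#0 graph x)) ⟩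
    deg x * recip (deg#0 graph x) * w x y
      ≈⟨ *-congʳ (recip-inverseʳ (deg#0 graph x)) ⟩
    1# * w x y
      ≈⟨ *-identityˡ (w x y) ⟩
    w x y ∎

  0≤p : ∀ x y → 0# ≤ p x y
  0≤p x y = *-nonneg (w-nonneg x y) (<⇒≤ (recip-pos (deg-pos graph x)))

  Σp≈1 : ∀ x → sum (p x) ≈ 1#
  Σp≈1 x = trans (sym (*-distribʳ-sum (recip (deg#0 graph x)) (w x))) (recip-inverseʳ (deg#0 graph x))

  p-pos : ∀ {x y} → x ~ y → 0# < p x y
  p-pos {x} {y} x~y = *-pos (Equivalence.from (w-positive x y) x~y) (recip-pos (deg-pos graph x))

  p-*-mono-≤ : ∀ x y {s t : ℝ} → (x ~ y → s ≤ t) → p x y * s ≤ p x y * t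
  p-*-mono-≤ x y {s} {t} s≤t with x ~? y
  ... | yes x~y = *-monoʳ-≤ (0≤p x y) (s≤t x~y)
  ... | no  x≁y = ≤-reflexive (trans (vanish s) (sym (vanish t)))
    where
    vanish : ∀ s → p x y * s ≈ 0#
    vanish s = trans (*-congʳ (trans (*-congʳ (w-nonedge x≁y)) (zeroˡ _))) (zeroˡ s)

  sumPaths-cong : ∀ k {F G : Vec (Fin n) k → ℝ} → (∀ xs → F xs ≈ G xs) → sumPaths k F ≈ sumPaths k G
  sumPaths-cong zero    F≈G = F≈G []
  sumPaths-cong (suc k) F≈G = sum-cong {n} (λ x → sumPaths-cong k (λ xs → F≈G (x ∷ xs)))

  sumPaths-*ˡ : ∀ k r (F : Vec (Fin n) k → ℝ) → sumPaths k (λ xs → r * F xs) ≈ r * sumPaths k F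
  sumPaths-*ˡ zero    r F = refl
  sumPaths-*ˡ (suc k) r F = trans
    (sum-cong {n} (λ x → sumPaths-*ˡ k r (λ xs → F (x ∷ xs))))
    (sym (*-distribˡ-sum r (λ x → sumPaths k (λ xs → F (x ∷ xs)))))

  sumPaths-sum : ∀ k {m} (F : Fin m → Vec (Fin n) k → ℝ) →
    sumPaths k (λ xs → sum (λ e → F e xs)) ≈ sum (λ e → sumPaths k (F e))
  sumPaths-sum zero        F = refl
  sumPaths-sum (suc k) {m} F = trans
    (sum-cong {n} (λ x → sumPaths-sum k (λ e xs → F e (x ∷ xs))))
    (∑-comm {n} {m} (λ x e → sumPaths k (λ xs → F e (x ∷ xs))))

-- Convergence of the mean holonomy series.

module ReturnHolonomy {c ℓ₁ ℓ₂ ℓ₃} (𝓡 : RealNumbers c ℓ₁ ℓ₂ ℓ₃)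
  {n d : ℕ} (Γ : Graphs.ConnectionGraph 𝓡 n d) (i : Fin n) where
  open RealNumbers 𝓡
  open OrderedFieldProperties 𝓡
  open FiniteSums 𝓡
  open Limits 𝓡
  open Matrices 𝓡
  open MatrixProperties 𝓡
  open Graphs.ConnectionGraph Γ
  open Connection 𝓡 Γ
  open ConnectionProperties 𝓡 Γ
  open RandomWalk 𝓡 Γ
  open FirstPassage 𝓡 p 0≤p Σp≈1 i
  open SetoidReasoning setoid

  onFirstReturn-∷ : ∀ {k} (F : Vec (Fin n) (suc (suc k)) → ℝ) y xs →
    onFirstReturn i F (y ∷ xs) ≡ killed (λ y → onFirstReturn i (λ xs → F (y ∷ xs)) xs) y
  onFirstReturn-∷ F y xs with y ≟ i
  ... | yes _ = ≡.refl
  ... | no  _ = ≡.refl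

  𝔼-zero : ∀ x (F : Vec (Fin n) 1 → ℝ) → 𝔼 x (onFirstReturn i F) ≈ p x i * F (i ∷ [])
  𝔼-zero x F = trans (sum-cong {n} select) (sum-select i (λ y → p x y * F (y ∷ [])))
    where
    select : ∀ y → (p x y * 1#) * onFirstReturn i F (y ∷ []) ≈ (if does (y ≟ i) then p x y * F (y ∷ []) else 0#)
    select y with y ≟ i
    ... | yes _ = *-congʳ (*-identityʳ (p x y))
    ... | no  _ = zeroʳ _

  -- Conditioning on the first step: a path of at least two steps makes its first visit to `i` at
  -- its end exactly when its first vertex is not `i` and the remaining path does the same.
  𝔼-suc : ∀ {k} x (F : Vec (Fin n) (suc (suc k)) → ℝ) →
    𝔼 x (onFirstReturn i F) ≈ step (λ y → 𝔼 y (onFirstReturn i (λ xs → F (y ∷ xs)))) x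
  𝔼-suc {k} x F = sum-cong {n} λ y → begin
    sumPaths (suc k) (λ xs → (p x y * pathProbability y xs) * onFirstReturn i F (y ∷ xs))
      ≈⟨ sumPaths-cong (suc k) (λ xs → trans (*-assoc (p x y) (pathProbability y xs) _)
           (*-congˡ (*-congˡ (reflexive (onFirstReturn-∷ F y xs))))) ⟩
    sumPaths (suc k) (λ xs → p x y * (pathProbability y xs * killed (λ y → onFirstReturn i (λ xs → F (y ∷ xs)) xs) y))
      ≈⟨ sumPaths-*ˡ (suc k) (p x y)
           (λ xs → pathProbability y xs * killed (λ y → onFirstReturn i (λ xs → F (y ∷ xs)) xs) y) ⟩
    p x y * sumPaths (suc k) (λ xs → pathProbability y xs * killed (λ y → onFirstReturn i (λ xs → F (y ∷ xs)) xs) y)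
      ≈⟨ *-congˡ (kill y) ⟩
    p x y * killed (λ y → 𝔼 y (onFirstReturn i (λ xs → F (y ∷ xs)))) y ∎
    where
    kill : ∀ y → sumPaths (suc k) (λ xs → pathProbability y xs * killed (λ y → onFirstReturn i (λ xs → F (y ∷ xs)) xs) y) ≈
                 killed (λ y → 𝔼 y (onFirstReturn i (λ xs → F (y ∷ xs)))) y
    kill y with does (y ≟ i)
    ... | false = refl
    ... | true  = trans
      -- The zero function is written as a product so that its factor `0#` can be pulled out of the
      -- sum over paths.
      (sumPaths-cong (suc k) {G = λ _ → 0# * 0#} (λ xs → trans (zeroʳ (pathProbability y xs)) (sym (zeroˡ 0#))))
      (trans (sumPaths-*ˡ (suc k) 0# (λ _ → 0#)) (zeroˡ _))

  killed-cong : ∀ {f g : Fin n → ℝ} y → f y ≈ g y → killed f y ≈ killed g y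
  killed-cong y f≈g with does (y ≟ i)
  ... | true  = refl
  ... | false = f≈g

  step-cong : ∀ {f g : Fin n → ℝ} → (∀ y → f y ≈ g y) → ∀ x → step f x ≈ step g x
  step-cong {f} {g} f≈g x = sum-cong {n} (λ y → *-congˡ (killed-cong {f} {g} y (f≈g y)))

  𝔼-firstPassage : ∀ k x → 𝔼 x {suc k} (onFirstReturn i (λ _ → 1#)) ≈ firstPassage k x
  𝔼-firstPassage zero    x = trans (𝔼-zero x (λ _ → 1#)) (*-identityʳ (p x i))
  𝔼-firstPassage (suc k) x = trans (𝔼-suc {k} x (λ _ → 1#)) (step-cong (𝔼-firstPassage k) x)

  -- Term `k` of the series for column `b` of H. The start varies even where only walks from `i`
  -- matter in the end, since after one step the walk is elsewhere.
  contribution : Fin d → ℕ → Section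
  contribution b k x a = 𝔼 x {suc k} (onFirstReturn i (λ xs → pathHolonomy x xs a b))

  contribution-zero : ∀ b x a → contribution b 0 x a ≈ p x i * σ₀ x i a b
  contribution-zero b x a = trans (𝔼-zero x (λ xs → pathHolonomy x xs a b))
    (*-congˡ (I-act′ (σ₀ x i a) b))

  contribution-suc : ∀ b k x a →
    contribution b (suc k) x a ≈ step (λ y → transport x y (contribution b k y) a) x
  contribution-suc b k x a = trans (𝔼-suc {k} x (λ xs → pathHolonomy x xs a b)) (step-cong linear x)
    where
    onFirstReturn-sum : ∀ y (xs : Vec (Fin n) (suc k)) →
      pathProbability y xs * onFirstReturn i (λ xs → sum (λ e → σ₀ x y a e * pathHolonomy y xs e b)) xs ≈
      sum (λ e → σ₀ x y a e * (pathProbability y xs * onFirstReturn i (λ xs → pathHolonomy y xs e b) xs))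
    onFirstReturn-sum y xs = trans (*-congˡ (push (does (firstReturn? i xs)))) (trans
      (*-distribˡ-sum (pathProbability y xs)
        (λ e → σ₀ x y a e * onFirstReturn i (λ xs → pathHolonomy y xs e b) xs))
      (sum-cong {d} (λ e → solve 3 (λ p s h → p :* (s :* h) := s :* (p :* h)) refl
        (pathProbability y xs) (σ₀ x y a e) (onFirstReturn i (λ xs → pathHolonomy y xs e b) xs))))
      where
      push : ∀ (t : Bool) →
        (if t then sum (λ e → σ₀ x y a e * pathHolonomy y xs e b) else 0#) ≈
        sum (λ e → σ₀ x y a e * (if t then pathHolonomy y xs e b else 0#))
      push true  = refl
      push false = sym (sum-zero {d} (λ e → zeroʳ (σ₀ x y a e)))
    linear : ∀ y → 𝔼 y {suc k} (onFirstReturn i (λ xs → pathHolonomy x (y ∷ xs) a b)) ≈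
                   transport x y (contribution b k y) a
    linear y = begin
      sumPaths (suc k) (λ xs → pathProbability y xs *
        onFirstReturn i (λ xs → sum (λ e → σ₀ x y a e * pathHolonomy y xs e b)) xs)
        ≈⟨ sumPaths-cong (suc k) (onFirstReturn-sum y) ⟩
      sumPaths (suc k) (λ xs → sum (λ e →
        σ₀ x y a e * (pathProbability y xs * onFirstReturn i (λ xs → pathHolonomy y xs e b) xs)))
        ≈⟨ sumPaths-sum (suc k) (λ e xs →
             σ₀ x y a e * (pathProbability y xs * onFirstReturn i (λ xs → pathHolonomy y xs e b) xs)) ⟩
      sum (λ e → sumPaths (suc k) (λ xs →
        σ₀ x y a e * (pathProbability y xs * onFirstReturn i (λ xs → pathHolonomy y xs e b) xs)))
        ≈⟨ sum-cong {d} (λ e → sumPaths-*ˡ (suc k) (σ₀ x y a e)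
             (λ xs → pathProbability y xs * onFirstReturn i (λ xs → pathHolonomy y xs e b) xs)) ⟩
      sum (λ e → σ₀ x y a e * contribution b k y e) ∎

  2-*-≤-square+1 : ∀ t → (1# + 1#) * t ≤ t * t + 1#
  2-*-≤-square+1 t = 0≤-⇒≤ (≤-respʳ
    (solve 1 (λ t → (t :- 1:) :* (t :- 1:) := (t :* t :+ 1:) :- (1: :+ 1:) :* t) refl t)
    (0≤square (t - 1#)))

  square-≤-dot : ∀ {m} (v : Fin m → ℝ) a → v a * v a ≤ dot v v
  square-≤-dot v zero    = ≤-respˡ (+-identityʳ _) (+-mono-≤ (≤-reflexive refl)
    (sum-nonneg (λ a → v (suc a) * v (suc a)) (λ a → 0≤square (v (suc a)))))
  square-≤-dot v (suc a) = ≤-respˡ (+-identityˡ _)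
    (+-mono-≤ (0≤square (v zero)) (square-≤-dot (λ a → v (suc a)) a))

  transportStep : Section → Section
  transportStep Φ x a = step (λ y → transport x y (Φ y) a) x

  killed-dot : ∀ (Φ : Section) x ξ y → sum (λ a → ξ a * killed (λ y → transport x y (Φ y) a) y) ≈
               killed (λ y → dot (transport y x ξ) (Φ y)) y
  killed-dot Φ x ξ y with does (y ≟ i)
  ... | true  = sum-zero {d} (λ a → zeroʳ (ξ a))
  ... | false = transport-adjoint x y ξ (Φ y)

  transportStep-dot : ∀ (Φ : Section) x ξ →
    dot ξ (transportStep Φ x) ≈ step (λ y → dot (transport y x ξ) (Φ y)) x
  transportStep-dot Φ x ξ = begin
    sum (λ a → ξ a * sum (λ y → p x y * killed (λ y → transport x y (Φ y) a) y))
      ≈⟨ *-sum-comm ξ (λ a y → p x y * killed (λ y → transport x y (Φ y) a) y) ⟩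
    sum (λ y → sum (λ a → ξ a * (p x y * killed (λ y → transport x y (Φ y) a) y)))
      ≈⟨ sum-cong {n} (λ y → trans
           (sum-cong {d} (λ a → solve 3 (λ ξ p t → ξ :* (p :* t) := p :* (ξ :* t)) refl
             (ξ a) (p x y) (killed (λ y → transport x y (Φ y) a) y)))
           (sym (*-distribˡ-sum (p x y) (λ a → ξ a * killed (λ y → transport x y (Φ y) a) y)))) ⟩
    sum (λ y → p x y * sum (λ a → ξ a * killed (λ y → transport x y (Φ y) a) y))
      ≈⟨ sum-cong {n} (λ y → *-congˡ (killed-dot Φ x ξ y)) ⟩
    step (λ y → dot (transport y x ξ) (Φ y)) x ∎

  -- For q ≥ 0, the inequality 2⟨ξ, v⟩ ≤ q (⟨ξ, ξ⟩ + 1) for all ξ says |v| ≤ q without a square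
  -- root, and it is linear in v, so averaging preserves it. Transport moves over to `ξ` without
  -- changing its norm; hence the factor `s` is common to all neighbours.
  transportStep-bound : ∀ (Φ : Section) (q : Fin n → ℝ) x →
    (∀ y ξ → (1# + 1#) * dot ξ (Φ y) ≤ q y * (dot ξ ξ + 1#)) →
    ∀ ξ → (1# + 1#) * dot ξ (transportStep Φ x) ≤ step q x * (dot ξ ξ + 1#)
  transportStep-bound Φ q x bound ξ = ≤-respˡ (sym expand) (≤-respʳ collect
    (sum-mono-≤ (λ y → p x y * ((1# + 1#) * killed f y)) (λ y → p x y * (s * killed q y))
      (λ y → p-*-mono-≤ x y (λ x~y → killed-scale-≤ (1# + 1#) s {f} {q} y (termwise y x~y)))))
    where
    s : ℝ
    s = dot ξ ξ + 1#
    f : Fin n → ℝ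
    f y = dot (transport y x ξ) (Φ y)
    termwise : ∀ y → x ~ y → (1# + 1#) * f y ≤ s * q y
    termwise y x~y = ≤-trans (bound y (transport y x ξ)) (≤-reflexive (trans
      (*-congˡ (+-congʳ (transport-isometry (~-sym x~y) ξ))) (*-comm (q y) s)))
    rescale : ∀ r (g : Fin n → ℝ) → r * step g x ≈ sum (λ y → p x y * (r * killed g y))
    rescale r g = trans (*-distribˡ-sum r (λ y → p x y * killed g y))
      (sum-cong {n} (λ y → solve 3 (λ r p t → r :* (p :* t) := p :* (r :* t)) refl r (p x y) (killed g y)))
    expand : (1# + 1#) * dot ξ (transportStep Φ x) ≈ sum (λ y → p x y * ((1# + 1#) * killed f y))
    expand = trans (*-congˡ (transportStep-dot Φ x ξ)) (rescale (1# + 1#) f)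
    collect : sum (λ y → p x y * (s * killed q y)) ≈ step q x * s
    collect = trans (sym (rescale s q)) (*-comm s (step q x))

  -- Quantified over ξ since the induction step replaces ξ by its transport,
  -- which has the same norm.
  contribution-bound : ∀ b k x ξ → (1# + 1#) * dot ξ (contribution b k x) ≤ firstPassage k x * (dot ξ ξ + 1#)
  contribution-bound b zero x ξ = ≤-respˡ (sym expand) (p-*-mono-≤ x i (λ x~i →
    -- This is 2t ≤ t² + 1 for the coordinate t at `b` of the transported `ξ`; its square is at most
    -- the squared norm of `ξ`.
    ≤-trans (2-*-≤-square+1 (transport i x ξ b))
      (+-mono-≤ (≤-trans (square-≤-dot (transport i x ξ) b)
                         (≤-reflexive (transport-isometry (~-sym x~i) ξ)))
                (≤-reflexive refl))))
    where
    expand : (1# + 1#) * dot ξ (contribution b 0 x) ≈ p x i * ((1# + 1#) * transport i x ξ b)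
    expand = begin
      (1# + 1#) * dot ξ (contribution b 0 x)
        ≈⟨ *-congˡ (sum-cong {d} (λ a → begin
             ξ a * contribution b 0 x a
               ≈⟨ *-congˡ (trans (contribution-zero b x a) (*-congˡ (σ₀-transpose x i a b))) ⟩
             ξ a * (p x i * σ₀ i x b a)
               ≈⟨ solve 3 (λ ξ p s → ξ :* (p :* s) := p :* (s :* ξ)) refl (ξ a) (p x i) (σ₀ i x b a) ⟩
             p x i * (σ₀ i x b a * ξ a) ∎)) ⟩
      (1# + 1#) * sum (λ a → p x i * (σ₀ i x b a * ξ a))
        ≈⟨ *-congˡ (*-distribˡ-sum (p x i) (λ a → σ₀ i x b a * ξ a)) ⟨
      (1# + 1#) * (p x i * transport i x ξ b)
        ≈⟨ solve 2 (λ p t → (1: :+ 1:) :* (p :* t) := p :* ((1: :+ 1:) :* t)) refl (p x i) (transport i x ξ b) ⟩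
      p x i * ((1# + 1#) * transport i x ξ b) ∎
  contribution-bound b (suc k) x ξ =
    ≤-respˡ (*-congˡ (sum-cong {d} (λ a → *-congˡ (sym (contribution-suc b k x a)))))
      (transportStep-bound (contribution b k) (firstPassage k) x (contribution-bound b k) ξ)

  -- Testing against `s` times a unit vector reads off one signed entry. The signs 1 and -1 yield
  -- the two hypotheses of `comparison-test`.
  contribution-sign-bound : ∀ s → s * s ≈ 1# → ∀ b x a k → s * contribution b k x a ≤ firstPassage k x
  contribution-sign-bound s s²≈1 b x a k = double-cancel-≤ (≤-respˡ lhs (≤-respʳ rhs
    (contribution-bound b k x (λ e → s * I a e))))
    where
    dot-s : ∀ v → dot (λ e → s * I a e) v ≈ s * v a
    dot-s v = trans (sum-cong {d} (λ e → *-assoc s (I a e) (v e)))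
      (trans (sym (*-distribˡ-sum s (λ e → I a e * v e))) (*-congˡ (I-act v a)))
    I-diagonal : I a a ≈ 1#
    I-diagonal with a ≟ a
    ... | yes _  = refl
    ... | no a≢a = ⊥-elim (a≢a ≡.refl)
    lhs : (1# + 1#) * dot (λ e → s * I a e) (contribution b k x) ≈
          s * contribution b k x a + s * contribution b k x a
    lhs = trans (*-congˡ (dot-s (contribution b k x)))
      (solve 1 (λ t → (1: :+ 1:) :* t := t :+ t) refl (s * contribution b k x a))
    rhs : firstPassage k x * (dot (λ e → s * I a e) (λ e → s * I a e) + 1#) ≈ firstPassage k x + firstPassage k x
    rhs = trans
      (*-congˡ (+-congʳ (trans (dot-s (λ e → s * I a e))
        (trans (sym (*-assoc s s (I a a))) (trans (*-cong s²≈1 I-diagonal) (*-identityˡ 1#))))))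
      (solve 1 (λ q → q :* (1: :+ 1:) := q :+ q) refl (firstPassage k x))

  survival-limit : ∀ x → ConvergesTo (λ k → survival k x) 0#
  survival-limit = survival-vanishes {_~_} p-pos connected

  opaque
    holonomySum : ∀ x a b → ∃[ l ] SumsTo (λ k → contribution b k x a) l
    holonomySum x a b = comparison-test {λ k → contribution b k x a} {λ k → firstPassage k x}
      (λ k → ≤-respˡ (*-identityˡ _) (contribution-sign-bound 1# (*-identityˡ 1#) b x a k))
      (λ k → ≤-respˡ (solve 1 (λ t → (:- 1:) :* t := :- t) refl (contribution b k x a))
        (contribution-sign-bound (- 1#) (solve 0 ((:- 1:) :* (:- 1:) := 1:) refl) b x a k))
      (firstPassage-sums x (survival-limit x))

  hittingHolonomy : Fin n → Matrix d d
  hittingHolonomy x a b = proj₁ (holonomySum x a b)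

  isMeanReturnHolonomy : IsMeanReturnHolonomy i (hittingHolonomy i)
  isMeanReturnHolonomy =
    ConvergesTo-cong (λ N → sum-cong {N} (λ k → sym (𝔼-firstPassage (toℕ k) i))) refl
      (firstPassage-sums i (survival-limit i)) ,
    λ a b → proj₂ (holonomySum i a b)

-- Harmonic extension from a vertex, and the defect I - Ω.

module HarmonicExtension {c ℓ₁ ℓ₂ ℓ₃} (𝓡 : RealNumbers c ℓ₁ ℓ₂ ℓ₃)
  {n d : ℕ} (Γ : Graphs.ConnectionGraph 𝓡 n d) (i : Fin n) where
  open RealNumbers 𝓡
  open OrderedFieldProperties 𝓡
  open FiniteSums 𝓡
  open Limits 𝓡
  open Matrices 𝓡
  open MatrixProperties 𝓡
  open PositiveForms 𝓡
  open Graphs.ConnectionGraph Γ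
  open Connection 𝓡 Γ
  open Degrees 𝓡 using (deg-pos)
  open ConnectionProperties 𝓡 Γ
  open RandomWalk 𝓡 Γ
  open FirstPassage 𝓡 p 0≤p Σp≈1 i
  open ReturnHolonomy 𝓡 Γ i
  open SetoidReasoning setoid

  boundary : Fin d → Section → Section
  boundary b Φ x a = if does (x ≟ i) then I a b else Φ x a

  average : Section → Section
  average Φ x a = sum (λ y → p x y * transport x y (Φ y) a)

  partialHolonomy : Fin d → ℕ → Section
  partialHolonomy b N x a = partialSum (λ k → contribution b k x a) N

  -- A path to `i` of at most N + 1 steps is one step followed by a path of at most `N` steps, or by
  -- nothing if the step reaches `i`; the boundary value I stands for the empty continuation.
  partialHolonomy-suc : ∀ b N x a → partialHolonomy b (suc N) x a ≈ average (boundary b (partialHolonomy b N)) x a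
  partialHolonomy-suc b zero x a = begin
    contribution b 0 x a + 0#
      ≈⟨ +-identityʳ _ ⟩
    contribution b 0 x a
      ≈⟨ contribution-zero b x a ⟩
    p x i * σ₀ x i a b
      ≈⟨ sum-select i (λ y → p x y * σ₀ x y a b) ⟨
    sum (λ y → if does (y ≟ i) then p x y * σ₀ x y a b else 0#)
      ≈⟨ sum-cong {n} at ⟨
    average (boundary b (λ _ _ → 0#)) x a ∎
    where
    at : ∀ y → p x y * transport x y (boundary b (λ _ _ → 0#) y) a ≈ (if does (y ≟ i) then p x y * σ₀ x y a b else 0#)
    at y with does (y ≟ i)
    ... | true  = *-congˡ (I-act′ (σ₀ x y a) b)
    ... | false = trans (*-congˡ (sum-zero {d} (λ e → zeroʳ (σ₀ x y a e)))) (zeroʳ (p x y))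
  partialHolonomy-suc b (suc N) x a = begin
    partialHolonomy b (suc (suc N)) x a
      ≈⟨ partialSum-suc (λ k → contribution b k x a) (suc N) ⟩
    partialHolonomy b (suc N) x a + contribution b (suc N) x a
      ≈⟨ +-cong (partialHolonomy-suc b N x a) (contribution-suc b N x a) ⟩
    average (boundary b (partialHolonomy b N)) x a + step (λ y → transport x y (contribution b N y) a) x
      ≈⟨ ∑-distrib-+ (λ y → p x y * transport x y (boundary b (partialHolonomy b N) y) a)
                     (λ y → p x y * killed (λ y → transport x y (contribution b N y) a) y) ⟨
    sum (λ y → p x y * transport x y (boundary b (partialHolonomy b N) y) a +
               p x y * killed (λ y → transport x y (contribution b N y) a) y)
      ≈⟨ sum-cong {n} (λ y → trans (sym (distribˡ (p x y) _ _)) (*-congˡ (extend y))) ⟩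
    average (boundary b (partialHolonomy b (suc N))) x a ∎
    where
    extend : ∀ y → transport x y (boundary b (partialHolonomy b N) y) a +
                   killed (λ y → transport x y (contribution b N y) a) y ≈
                   transport x y (boundary b (partialHolonomy b (suc N)) y) a
    extend y with does (y ≟ i)
    ... | true  = +-identityʳ _
    ... | false = trans
      (sym (∑-distrib-+ (λ e → σ₀ x y a e * partialHolonomy b N y e) (λ e → σ₀ x y a e * contribution b N y e)))
      (sum-cong {d} (λ e → trans (sym (distribˡ (σ₀ x y a e) (partialHolonomy b N y e) (contribution b N y e)))
        (*-congˡ (sym (partialSum-suc (λ k → contribution b k y e) N)))))

  -- Overwriting is needed at `i`, where the series counts paths of at least one step and so sums to
  -- Ω instead of I.
  harmonic : Fin d → Section
  harmonic b = boundary b (λ x a → hittingHolonomy x a b)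

  hittingHolonomy-average : ∀ b x a → hittingHolonomy x a b ≈ average (harmonic b) x a
  hittingHolonomy-average b x a = limit-unique
    {λ N → partialHolonomy b (suc N) x a} {hittingHolonomy x a b} {average (harmonic b) x a}
    (ConvergesTo-suc {λ N → partialHolonomy b N x a} {hittingHolonomy x a b} (proj₂ (holonomySum x a b)))
    (ConvergesTo-cong {λ N → average (boundary b (partialHolonomy b N)) x a}
      {λ N → partialHolonomy b (suc N) x a} {average (harmonic b) x a} {average (harmonic b) x a}
      (λ N → sym (partialHolonomy-suc b N x a)) refl average-limit)
    where
    boundary-limit : ∀ y e → ConvergesTo (λ N → boundary b (partialHolonomy b N) y e) (harmonic b y e)
    boundary-limit y e with does (y ≟ i)
    ... | true  = ConvergesTo-const (I e b)
    ... | false = proj₂ (holonomySum y e b)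
    average-limit : ConvergesTo (λ N → average (boundary b (partialHolonomy b N)) x a) (average (harmonic b) x a)
    average-limit = ConvergesTo-sum {n}
      {λ y N → p x y * transport x y (boundary b (partialHolonomy b N) y) a}
      {λ y → p x y * transport x y (harmonic b y) a}
      (λ y → ConvergesTo-*ˡ {λ N → transport x y (boundary b (partialHolonomy b N) y) a}
        {transport x y (harmonic b y) a} (p x y)
        (ConvergesTo-sum {d}
          {λ e N → σ₀ x y a e * boundary b (partialHolonomy b N) y e}
          {λ e → σ₀ x y a e * harmonic b y e}
          (λ e → ConvergesTo-*ˡ {λ N → boundary b (partialHolonomy b N) y e} {harmonic b y e}
            (σ₀ x y a e) (boundary-limit y e))))

  defect : Matrix d d
  defect = I ⊖ hittingHolonomy i

  -- The average of `harmonic b` is the value of the series at every vertex, `i` included. Off `i`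
  -- this is the value of `harmonic b` and cancels; at `i` the values I and Ω differ by the defect.
  laplacian-harmonic : ∀ b x a → laplacian (harmonic b) x a ≈ (if does (x ≟ i) then deg x * defect a b else 0#)
  laplacian-harmonic b x a = begin
    laplacian (harmonic b) x a
      ≈⟨ laplacian-deg (harmonic b) x a ⟩
    deg x * harmonic b x a - sum (λ y → w x y * transport x y (harmonic b y) a)
      ≈⟨ +-congˡ (-‿cong (sum-cong {n} (λ y →
           trans (*-congʳ (sym (deg-*-p x y))) (*-assoc (deg x) (p x y) (transport x y (harmonic b y) a))))) ⟩
    deg x * harmonic b x a - sum (λ y → deg x * (p x y * transport x y (harmonic b y) a))
      ≈⟨ +-congˡ (-‿cong (trans
           (sym (*-distribˡ-sum (deg x) (λ y → p x y * transport x y (harmonic b y) a)))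
           (*-congˡ (sym (hittingHolonomy-average b x a))))) ⟩
    deg x * harmonic b x a - deg x * hittingHolonomy x a b
      ≈⟨ at ⟩
    (if does (x ≟ i) then deg x * defect a b else 0#) ∎
    where
    at : deg x * harmonic b x a - deg x * hittingHolonomy x a b ≈ (if does (x ≟ i) then deg x * defect a b else 0#)
    at with x ≟ i
    ... | yes ≡.refl = solve 3 (λ d s t → d :* s :- d :* t := d :* (s :- t)) refl
                         (deg x) (I a b) (hittingHolonomy x a b)
    ... | no  _      = -‿inverseʳ (deg x * hittingHolonomy x a b)

  extension : (Fin d → ℝ) → Section
  extension v x a = sum (λ b → harmonic b x a * v b)

  extension-boundary : ∀ v a → extension v i a ≈ v a
  extension-boundary v a with i ≟ i
  ... | yes _  = I-act v a
  ... | no i≢i = ⊥-elim (i≢i ≡.refl)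

  laplacian-linear : ∀ v x a → laplacian (extension v) x a ≈ sum (λ b → laplacian (harmonic b) x a * v b)
  laplacian-linear v x a = begin
    sum (λ y → sum (λ e → laplacianBlock x y a e * sum (λ b → harmonic b y e * v b)))
      ≈⟨ sum-cong {n} (λ y → *-sum-assoc (laplacianBlock x y a) (λ e b → harmonic b y e) v) ⟩
    sum (λ y → sum (λ b → sum (λ e → laplacianBlock x y a e * harmonic b y e) * v b))
      ≈⟨ ∑-comm {n} {d} (λ y b → sum (λ e → laplacianBlock x y a e * harmonic b y e) * v b) ⟩
    sum (λ b → sum (λ y → sum (λ e → laplacianBlock x y a e * harmonic b y e) * v b))
      ≈⟨ sum-cong {d} (λ b → *-distribʳ-sum (v b) (λ y → sum (λ e → laplacianBlock x y a e * harmonic b y e))) ⟨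
    sum (λ b → laplacian (harmonic b) x a * v b) ∎

  laplacian-extension : ∀ v x a →
    laplacian (extension v) x a ≈ (if does (x ≟ i) then deg i * sum (λ b → defect a b * v b) else 0#)
  laplacian-extension v x a = trans (laplacian-linear v x a)
    (trans (sum-cong {d} (λ b → *-congʳ (laplacian-harmonic b x a))) at)
    where
    at : sum (λ b → (if does (x ≟ i) then deg x * defect a b else 0#) * v b) ≈
         (if does (x ≟ i) then deg i * sum (λ b → defect a b * v b) else 0#)
    at with x ≟ i
    ... | yes ≡.refl = trans (sum-cong {d} (λ b → *-assoc (deg x) (defect a b) (v b)))
                             (sym (*-distribˡ-sum (deg x) (λ b → defect a b * v b)))
    ... | no _       = sum-zero {d} (λ b → zeroˡ (v b))

  -- The Laplacian of an extension is supported at `i`, where `extension u` equals `u`. The identity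
  -- carries symmetry and positivity of the Laplacian over to the defect.
  extension-form : ∀ u v →
    ⟪ extension u , laplacian (extension v) ⟫ ≈ deg i * sum (λ a → u a * sum (λ b → defect a b * v b))
  extension-form u v = begin
    sum (λ x → sum (λ a → extension u x a * laplacian (extension v) x a))
      ≈⟨ sum-cong {n} (λ x → sum-cong {d} (λ a → *-congˡ (laplacian-extension v x a))) ⟩
    sum (λ x → sum (λ a → extension u x a * (if does (x ≟ i) then deg i * Δ a else 0#)))
      ≈⟨ sum-cong {n} at ⟩
    sum (λ x → if does (x ≟ i) then sum (λ a → extension u x a * (deg i * Δ a)) else 0#)
      ≈⟨ sum-select i (λ x → sum (λ a → extension u x a * (deg i * Δ a))) ⟩
    sum (λ a → extension u i a * (deg i * Δ a))
      ≈⟨ sum-cong {d} (λ a → trans (*-congʳ (extension-boundary u a))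
           (solve 3 (λ u d t → u :* (d :* t) := d :* (u :* t)) refl (u a) (deg i) (Δ a))) ⟩
    sum (λ a → deg i * (u a * Δ a))
      ≈⟨ *-distribˡ-sum (deg i) (λ a → u a * Δ a) ⟨
    deg i * sum (λ a → u a * Δ a) ∎
    where
    Δ : Fin d → ℝ
    Δ a = sum (λ b → defect a b * v b)
    at : ∀ x → sum (λ a → extension u x a * (if does (x ≟ i) then deg i * Δ a else 0#)) ≈
               (if does (x ≟ i) then sum (λ a → extension u x a * (deg i * Δ a)) else 0#)
    at x with does (x ≟ i)
    ... | true  = refl
    ... | false = sum-zero {d} (λ a → zeroʳ (sum (λ b → hittingHolonomy x a b * u b)))

  defect-symmetric : Symmetric defect
  defect-symmetric a b = *-cancelˡ (pos⇒# (deg-pos graph i)) (begin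
    deg i * defect b a
      ≈⟨ entry b a ⟨
    ⟪ extension (unit b) , laplacian (extension (unit a)) ⟫
      ≈⟨ laplacian-selfAdjoint (extension (unit b)) (extension (unit a)) ⟩
    ⟪ extension (unit a) , laplacian (extension (unit b)) ⟫
      ≈⟨ entry a b ⟩
    deg i * defect a b ∎)
    where
    unit : Fin d → Fin d → ℝ
    unit b e = I e b
    entry : ∀ a b → ⟪ extension (unit a) , laplacian (extension (unit b)) ⟫ ≈ deg i * defect a b
    entry a b = trans (extension-form (unit a) (unit b)) (*-congˡ (begin
      sum (λ e → I e a * sum (λ f → defect e f * I f b))
        ≈⟨ sum-cong {d} (λ e → *-cong (I-symmetric e a) (I-act′ (defect e) b)) ⟩
      sum (λ e → I a e * defect e b)
        ≈⟨ I-act (λ e → defect e b) a ⟩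
      defect a b ∎))

  quadraticForm-dot : ∀ v → sum (λ a → v a * sum (λ b → defect a b * v b)) ≈ quadraticForm defect v
  quadraticForm-dot v = sum-cong {d} (λ a → trans (*-distribˡ-sum (v a) (λ b → defect a b * v b))
    (sum-cong {d} (λ b → sym (*-assoc (v a) (defect a b) (v b)))))

  defect-positiveDefinite : AbsolutelyInconsistent → PositiveDefinite defect
  defect-positiveDefinite inconsistent = defect-symmetric , λ v (a , v#0) →
    *-cancelˡ-pos (deg-pos graph i) (<-respʳ-≈
      (trans (extension-form v v) (*-congˡ (quadraticForm-dot v)))
      -- The extension takes the value `v` at `i`, so a nonzero entry of `v` is one of the
      -- extension.
      (absolutelyInconsistent⇒energy-pos inconsistent (extension v) i a
        (#-congʳ (sym (extension-boundary v a)) v#0)))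

  defect-positive⇒solvable : PositiveForm defect →
    ∀ b → Σ[ Φ ∈ Section ] (∀ x a → laplacian Φ x a ≈ (if does (x ≟ i) then I a b else 0#))
  defect-positive⇒solvable defect>0 b =
    let r , _ , deg*r≈1 = ∃-quotient (deg-pos graph i) 0<1
        -- The factor `r` in the right-hand side cancels the degree that `laplacian-extension`
        -- produces at `i`.
        v , solves      = positive⇒solvable defect defect>0 (λ a → r * I a b)
    in extension v , λ x a → trans (laplacian-extension v x a)
         (if-cong (does (x ≟ i)) (begin
           deg i * sum (λ b → defect a b * v b)   ≈⟨ *-congˡ (solves a) ⟩
           deg i * (r * I a b)                    ≈⟨ *-assoc (deg i) r (I a b) ⟨
           deg i * r * I a b                      ≈⟨ *-congʳ deg*r≈1 ⟩
           1# * I a b                             ≈⟨ *-identityˡ (I a b) ⟩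
           I a b                                  ∎))
    where
    if-cong : ∀ (t : Bool) {x y : ℝ} → x ≈ y → (if t then x else 0#) ≈ (if t then y else 0#)
    if-cong true  x≈y = x≈y
    if-cong false x≈y = refl

theorem4p12 :
    ∀ {c ℓ₁ ℓ₂ ℓ₃} (𝓡 : RealNumbers c ℓ₁ ℓ₂ ℓ₃) (n d : ℕ)
    (Γ : Graphs.ConnectionGraph 𝓡 n d) →
    let open Matrices 𝓡
        open Connection 𝓡 Γ
    in Σ[ Ω¹ ∈ (Fin n → Matrix d d) ]
         (∀ i → IsMeanReturnHolonomy i (Ω¹ i)) ×
         (AbsolutelyInconsistent ⇔ (∀ i → PositiveDefinite (I ⊖ Ω¹ i)))
theorem4p12 𝓡 n d Γ =
  (λ i → ReturnHolonomy.hittingHolonomy 𝓡 Γ i i) ,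
  (λ i → ReturnHolonomy.isMeanReturnHolonomy 𝓡 Γ i) ,
  mk⇔ (λ inconsistent i → HarmonicExtension.defect-positiveDefinite 𝓡 Γ i inconsistent)
      (λ positive → ConnectionProperties.solvable⇒absolutelyInconsistent 𝓡 Γ
        (λ i → HarmonicExtension.defect-positive⇒solvable 𝓡 Γ i (proj₂ (positive i))))
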